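{- Let 2-BOX be the family of (finite, connected) intersection graphs of axis-parallel rectangles in $\mathbb{R}^2$. Then $3\leq \mathsf{c}(\text{2-BOX})\leq 13$.
   Context: A graph $G$ is an intersection graph of axis-parallel rectangles if each vertex $v$ can be assigned an axis-parallel rectangle $R_v\subseteq\mathbb{R}^2$ such that $uv\in E(G)$ iff $R_u\cap R_v\neq\emptyset$. In Cops and Robber on $G$, cops are placed first, then the robber; players alternate (cops first), each piece moving to an adjacent vertex or staying; cops win if a cop occupies the robber's vertex. $\mathsf{c}(G)$ is the minimum number of cops that guarantees a win, and for a family $\mathcal{F}$, $\mathsf{c}(\mathcal{F})=\max\{\mathsf{c}(G): G\in\mathcal{F}\}$.
   Formalization: The rectangles are closed and have rational instead of real corner coordinates; since a finite intersection graph depends only on the order of the coordinates, the family of graphs is the same. -}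

module Defs where

open import Data.Nat using (ℕ)
open import Data.Fin using (Fin)
open import Data.Rational using (ℚ; _≤_)
open import Data.Product using (Σ; ∃; _×_)
open import Data.Sum using (_⊎_)
open import Relation.Binary.PropositionalEquality using (_≡_; _≢_)
open import Relation.Nullary using (¬_)

-- A finite graph on vertex set Fin n, given by an adjacency relation.
-- (Simplicity/symmetry is enforced by the rectangle-intersection
-- condition in the family 2-BOX below.)
record Graph : Set₁ where
  field
    n   : ℕ
    Adj : Fin n → Fin n → Set
open Graph public

data Reach (G : Graph) : Fin (n G) → Fin (n G) → Set where
  here : ∀ {u} → Reach G u u
  step : ∀ {u v w} → Adj G u v → Reach G v w → Reach G u w

Connected : Graph → Set
Connected G = Fin (n G) × (∀ u v → Reach G u v)

record Rect : Set where
  field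
    x₁ x₂ y₁ y₂ : ℚ
    x₁≤x₂ : x₁ ≤ x₂
    y₁≤y₂ : y₁ ≤ y₂
open Rect public

_∈R_ : ℚ × ℚ → Rect → Set
p ∈R R = (x₁ R ≤ Data.Product.proj₁ p × Data.Product.proj₁ p ≤ x₂ R)
       × (y₁ R ≤ Data.Product.proj₂ p × Data.Product.proj₂ p ≤ y₂ R)

Meet : Rect → Rect → Set
Meet R S = Σ (ℚ × ℚ) λ p → (p ∈R R) × (p ∈R S)

IsBoxGraph : Graph → Set
IsBoxGraph G = Σ (Fin (n G) → Rect) λ R →
  (∀ u v → u ≢ v → (Adj G u v → Meet (R u) (R v)) × (Meet (R u) (R v) → Adj G u v))
  × (∀ u → ¬ Adj G u u)

TwoBox : Graph → Set
TwoBox G = Connected G × IsBoxGraph G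

module Game (G : Graph) (k : ℕ) where
  V = Fin (n G)
  Config = Fin k → V

  Move : V → V → Set
  Move a b = (b ≡ a) ⊎ Adj G a b

  CopMove : Config → Config → Set
  CopMove C C' = ∀ i → Move (C i) (C' i)

  Caught : Config → V → Set
  Caught C r = ∃ λ i → C i ≡ r

  -- WinC C r : cops to move, cops at C, robber at r; cops can force a
  -- capture (in finitely many rounds).  WinR: robber to move.
  data WinC (C : Config) (r : V) : Set
  data WinR (C : Config) (r : V) : Set

  data WinC C r where
    caughtC : Caught C r → WinC C r
    cops    : (C' : Config) → CopMove C C' → WinR C' r → WinC C r

  data WinR C r where
    caughtR : Caught C r → WinR C r
    robber  : (∀ r' → Move r r' → WinC C r') → WinR C r

-- k cops have a winning strategy on G: cops are placed first, then the
-- robber, then cops move first.  Equivalently c(G) ≤ k.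
CopWin : ℕ → Graph → Set
CopWin k G = Σ (Game.Config G k) λ C → ∀ r → Game.WinC G k C r

{-# OPTIONS --safe #-}
-- Upper bound. Place the rectangles on a finite grid. At every moment the robber is confined
-- to a region bounded by two guarded curves from adjacent grid points to a common root. Inside
-- such a region let the level of a point be the least number of changes of set on a curve from
-- the root to it. A curve that stays in one set per level is guarded by four cops: when the
-- robber's set has level k they occupy the sets of the curve at levels k - 2, k - 1, k and
-- k + 1, and a set touching the curve at a point of level i has level i or i + 1. A third such
-- curve, from the third corner of the triangle at the tip, splits the region into two smaller
-- ones, each bounded by two of the three curves; so twelve cops suffice. The splitting is mod 2
-- homology: a closed chain bounds exactly one set of faces.
--
-- Lower bound. The dodecahedron is a contact graph of rectangles. It is cubic and every other
-- vertex dominates at most one neighbour of a given vertex, so two cops never trap the robber.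
module Submission where

open import Defs
open import Data.Product using (Σ; _×_)
open import Relation.Nullary using (¬_)

open import Data.Bool.Base using (Bool; true; false; _∧_; _xor_; not; if_then_else_)
import Data.Bool.Properties as Bool
open import Data.Bool.Properties using (xor-same; xor-identityʳ; xor-assoc; ∧-comm; ∧-distribˡ-xor; ∧-distribʳ-xor; ∧-zeroʳ; ∧-identityʳ)
open import Data.Bool.Solver using (module xor-∧-Solver)
open import Data.Empty using (⊥; ⊥-elim)
open import Data.Fin using (Fin; zero; suc; combine; remQuot; inject₁; inject≤; #_)
open import Data.Fin.Induction using (<-weakInduction)
import Data.Fin.Properties as Fin
open import Data.Integer.Base using (+_)
open import Data.List.Base using (List; []; _∷_; _++_; map; cartesianProduct; upTo; allFin; tabulate)
open import Data.List.Membership.Propositional using (_∈_; _∉_; lose; find)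
import Data.List.Membership.DecPropositional as DecMem
open import Data.List.Membership.Propositional.Properties
  using (∈-cartesianProduct⁺; ∈-cartesianProduct⁻; ∈-upTo⁺; ∈-upTo⁻; ∈-allFin; ∈-map⁺; ∈-++⁺ˡ; ∈-++⁺ʳ; ∈-tabulate⁺)
open import Data.List.Relation.Binary.Subset.Propositional using (_⊆_)
open import Data.List.Relation.Unary.All as All using (All; all?)
open import Data.List.Relation.Unary.Any using (Any; here; there; any?)
open import Data.Nat.Base using (ℕ; zero; suc; _+_; _∸_; _⊔_; _⊓_; _≤_; _<_; _≡ᵇ_; _<ᵇ_; z≤n; s≤s; s≤s⁻¹)
open import Data.Nat.Coprimality as Coprime using (1-coprimeTo)
open import Data.Nat.Induction using (Acc; acc; <-wellFounded)
open import Data.Nat.Properties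
open import Data.Product using (∃; ∃₂; _,_; proj₁; proj₂; uncurry)
open import Data.Product.Properties using (≡-dec)
open import Data.Rational using (ℚ; mkℚ) renaming (_≤_ to _≤ℚ_; _<_ to _<ℚ_; _≤?_ to _≤ℚ?_; _<?_ to _<ℚ?_)
import Data.Rational.Properties as ℚ
open import Data.Sum using (_⊎_; inj₁; inj₂; [_,_]′; map₁)
open import Data.Unit.Base using (⊤; tt)
open import Data.Vec.Base using ([]; _∷_; lookup)
open import Function.Base using (_∘_; id)
open import Relation.Binary.Definitions using (DecidableEquality)
open import Relation.Binary.PropositionalEquality using (_≡_; _≢_; refl; sym; trans; cong; cong₂; subst)
open import Relation.Nullary using (Dec; yes; no; ¬?; map′; _×-dec_; _⊎-dec_; _→-dec_)
open import Relation.Nullary.Decidable using (True; toWitness; from-yes)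

-- Mod 2 chains on the triangulated quarter plane

-- The obstacle is planarity: the curves may share points and edges, so cutting along one has no
-- simple picture. Instead of a Jordan curve theorem each region carries `Maximal`: whatever is
-- bounded by edges in its closure already lies in it. This one property puts both pieces of a cut
-- inside the region, and the pieces inherit it. The diagonals make the grid a triangulation, so
-- that the closing edge of a region has a third corner from which the next curve starts; the
-- triangle there is lost to both pieces, which makes the number of faces drop. Levels are measured
-- inside the current region, since a shorter curve outside would not cut it; a guard made for a
-- region stays valid for all smaller ones. Rectangles are enlarged to connected sets covering the
-- grid, without new adjacencies, because every point must have a level. The robber counts as inside
-- only when his entire set is interior, so that touching a curve is already crossing it. Three
-- curves at four cops each give twelve duties; the thirteenth cop doubles one of them.

Pt : Set
Pt = ℕ × ℕ

data Edge : Set where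
  hE vE dE : ℕ → ℕ → Edge

-- Lo (suc x) y and Up x (suc y) are the triangles below and above the diagonal of the unit
-- square at (x , y). The shift gives every edge two sides: Lo 0 y and Up x 0 lie outside.
data Face : Set where
  Lo Up : ℕ → ℕ → Face

src tgt : Edge → Pt
src (hE x y) = x , y
src (vE x y) = x , y
src (dE x y) = x , y
tgt (hE x y) = suc x , y
tgt (vE x y) = x , suc y
tgt (dE x y) = suc x , suc y

lo up : Edge → Face
lo (hE x y) = Lo (suc x) y
lo (vE x y) = Lo x y
lo (dE x y) = Lo (suc x) y
up (hE x y) = Up x y
up (vE x y) = Up x (suc y)
up (dE x y) = Up x (suc y)

Chain Region : Set
Chain  = Edge → Bool
Region = Face → Bool

∂ : Region → Chain
∂ D e = D (lo e) xor D (up e)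

Grounded : Region → Set
Grounded D = (∀ y → D (Lo 0 y) ≡ false) × (∀ x → D (Up x 0) ≡ false)

infix 4 _≡ᵖ_ _≡ᵉ_ _≡ᶠ_

_≡ᵖ_ : Pt → Pt → Bool
(a , b) ≡ᵖ (x , y) = (a ≡ᵇ x) ∧ (b ≡ᵇ y)

_≡ᵉ_ : Edge → Edge → Bool
hE a b ≡ᵉ hE x y = (a ≡ᵇ x) ∧ (b ≡ᵇ y)
vE a b ≡ᵉ vE x y = (a ≡ᵇ x) ∧ (b ≡ᵇ y)
dE a b ≡ᵉ dE x y = (a ≡ᵇ x) ∧ (b ≡ᵇ y)
_      ≡ᵉ _      = false

_≡ᶠ_ : Face → Face → Bool
Lo a b ≡ᶠ Lo x y = (a ≡ᵇ x) ∧ (b ≡ᵇ y)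
Up a b ≡ᶠ Up x y = (a ≡ᵇ x) ∧ (b ≡ᵇ y)
_      ≡ᶠ _      = false

Joins : Edge → Pt → Pt → Set
Joins e p q = (src e ≡ p × tgt e ≡ q) ⊎ (src e ≡ q × tgt e ≡ p)

Joins-sym : ∀ {e p q} → Joins e p q → Joins e q p
Joins-sym (inj₁ x) = inj₂ x
Joins-sym (inj₂ x) = inj₁ x

inc-in : Pt → List Edge
inc-in (zero  , zero)  = []
inc-in (suc x , zero)  = hE x zero ∷ []
inc-in (zero  , suc y) = vE zero y ∷ []
inc-in (suc x , suc y) = hE x (suc y) ∷ vE (suc x) y ∷ dE x y ∷ []

inc : Pt → List Edge
inc (x , y) = hE x y ∷ vE x y ∷ dE x y ∷ inc-in (x , y)

xorSum : Chain → List Edge → Bool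
xorSum c []       = false
xorSum c (e ∷ es) = c e xor xorSum c es

bd : Chain → Pt → Bool
bd c p = xorSum c (inc p)

≡ᵇ-refl : ∀ n → (n ≡ᵇ n) ≡ true
≡ᵇ-refl zero    = refl
≡ᵇ-refl (suc n) = ≡ᵇ-refl n

≡ᵇ-sound : ∀ m n → (m ≡ᵇ n) ≡ true → m ≡ n
≡ᵇ-sound zero    zero    _  = refl
≡ᵇ-sound (suc m) (suc n) eq = cong suc (≡ᵇ-sound m n eq)

∧-split : ∀ {a b} → a ∧ b ≡ true → a ≡ true × b ≡ true
∧-split {true} {true} _ = refl , refl

pair-sound : ∀ a b x y → (a ≡ᵇ x) ∧ (b ≡ᵇ y) ≡ true → a ≡ x × b ≡ y
pair-sound a b x y eq = ≡ᵇ-sound a x (proj₁ (∧-split eq)) , ≡ᵇ-sound b y (proj₂ (∧-split eq))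

pair-refl : ∀ a b → (a ≡ᵇ a) ∧ (b ≡ᵇ b) ≡ true
pair-refl a b = cong₂ _∧_ (≡ᵇ-refl a) (≡ᵇ-refl b)

≡ᵖ-refl : ∀ p → (p ≡ᵖ p) ≡ true
≡ᵖ-refl (a , b) = pair-refl a b

≡ᵖ-sound : ∀ p q → (p ≡ᵖ q) ≡ true → p ≡ q
≡ᵖ-sound (a , b) (x , y) eq with pair-sound a b x y eq
... | refl , refl = refl

≡ᵉ-refl : ∀ e → (e ≡ᵉ e) ≡ true
≡ᵉ-refl (hE a b) = pair-refl a b
≡ᵉ-refl (vE a b) = pair-refl a b
≡ᵉ-refl (dE a b) = pair-refl a b

≡ᵉ-sound : ∀ e f → (e ≡ᵉ f) ≡ true → e ≡ f
≡ᵉ-sound (hE a b) (hE x y) eq with pair-sound a b x y eq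
... | refl , refl = refl
≡ᵉ-sound (vE a b) (vE x y) eq with pair-sound a b x y eq
... | refl , refl = refl
≡ᵉ-sound (dE a b) (dE x y) eq with pair-sound a b x y eq
... | refl , refl = refl

≡ᶠ-sound : ∀ e f → (e ≡ᶠ f) ≡ true → e ≡ f
≡ᶠ-sound (Lo a b) (Lo x y) eq with pair-sound a b x y eq
... | refl , refl = refl
≡ᶠ-sound (Up a b) (Up x y) eq with pair-sound a b x y eq
... | refl , refl = refl

not-true : ∀ {b} → b ≢ true → b ≡ false
not-true {true}  ne = ⊥-elim (ne refl)
not-true {false} _  = refl

true≢false : ∀ {b} → b ≡ true → b ≡ false → ⊥
true≢false refl ()

≡ᵉ-off : ∀ {e f} → e ≢ f → (e ≡ᵉ f) ≡ false
≡ᵉ-off {e} {f} ne = not-true λ eq → ne (≡ᵉ-sound e f eq)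

≡ᵖ-off : ∀ {p q} → p ≢ q → (p ≡ᵖ q) ≡ false
≡ᵖ-off {p} {q} ne = not-true λ eq → ne (≡ᵖ-sound p q eq)

xor-false⇒≡ : ∀ {a b} → a xor b ≡ false → a ≡ b
xor-false⇒≡ {true}  {true}  _ = refl
xor-false⇒≡ {false} {false} _ = refl

xor-cancel : ∀ a b → (a xor b) xor a ≡ b
xor-cancel true  true  = refl
xor-cancel true  false = refl
xor-cancel false true  = refl
xor-cancel false false = refl

xor-cancelˡ : ∀ a b → a xor (a xor b) ≡ b
xor-cancelˡ true  true  = refl
xor-cancelˡ true  false = refl
xor-cancelˡ false b = refl

src≢tgt : ∀ e → src e ≢ tgt e
src≢tgt (hE x y) ()
src≢tgt (vE x y) ()
src≢tgt (dE x y) ()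

Joins-functional : ∀ {e p q r} → Joins e p q → Joins e p r → q ≡ r
Joins-functional {e} (inj₁ (_ , refl)) (inj₁ (_ , refl)) = refl
Joins-functional {e} (inj₁ (refl , refl)) (inj₂ (_ , eq)) = ⊥-elim (src≢tgt e (sym eq))
Joins-functional {e} (inj₂ (refl , refl)) (inj₁ (eq , _)) = ⊥-elim (src≢tgt e eq)
Joins-functional {e} (inj₂ (refl , _)) (inj₂ (refl , _)) = refl

Joins-ends : ∀ {e p q a b} → Joins e p q → Joins e a b → p ≡ a ⊎ p ≡ b
Joins-ends (inj₁ (refl , _)) (inj₁ (refl , _)) = inj₁ refl
Joins-ends (inj₁ (refl , _)) (inj₂ (refl , _)) = inj₂ refl
Joins-ends (inj₂ (_ , refl)) (inj₁ (_ , refl)) = inj₂ refl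
Joins-ends (inj₂ (_ , refl)) (inj₂ (_ , refl)) = inj₁ refl

src∈inc : ∀ e → e ∈ inc (src e)
src∈inc (hE x y) = here refl
src∈inc (vE x y) = there (here refl)
src∈inc (dE x y) = there (there (here refl))

tgt∈inc : ∀ e → e ∈ inc (tgt e)
tgt∈inc (hE x zero)    = there (there (there (here refl)))
tgt∈inc (hE x (suc y)) = there (there (there (here refl)))
tgt∈inc (vE zero y)    = there (there (there (here refl)))
tgt∈inc (vE (suc x) y) = there (there (there (there (here refl))))
tgt∈inc (dE x y)       = there (there (there (there (there (here refl)))))

Joins⇒inc : ∀ {e p q} → Joins e p q → e ∈ inc p
Joins⇒inc {e} (inj₁ (refl , _)) = src∈inc e
Joins⇒inc {e} (inj₂ (_ , refl)) = tgt∈inc e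

inc⇒Joins : ∀ {e} p → e ∈ inc p → ∃ λ q → Joins e p q
inc⇒Joins p (here refl)                 = _ , inj₁ (refl , refl)
inc⇒Joins p (there (here refl))         = _ , inj₁ (refl , refl)
inc⇒Joins p (there (there (here refl))) = _ , inj₁ (refl , refl)
inc⇒Joins (suc x , zero)  (there (there (there (here refl)))) = _ , inj₂ (refl , refl)
inc⇒Joins (zero  , suc y) (there (there (there (here refl)))) = _ , inj₂ (refl , refl)
inc⇒Joins (suc x , suc y) (there (there (there (here refl)))) = _ , inj₂ (refl , refl)
inc⇒Joins (suc x , suc y) (there (there (there (there (here refl))))) = _ , inj₂ (refl , refl)
inc⇒Joins (suc x , suc y) (there (there (there (there (there (here refl)))))) = _ , inj₂ (refl , refl)

xorSum-xor : ∀ c d es → xorSum (λ e → c e xor d e) es ≡ xorSum c es xor xorSum d es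
xorSum-xor c d []       = refl
xorSum-xor c d (e ∷ es) rewrite xorSum-xor c d es =
  solve 4 (λ a b s t → (a :+ b) :+ (s :+ t) := (a :+ s) :+ (b :+ t)) refl
    (c e) (d e) (xorSum c es) (xorSum d es)
  where open xor-∧-Solver

xorSum-cong : ∀ {c d} es → (∀ {e} → e ∈ es → c e ≡ d e) → xorSum c es ≡ xorSum d es
xorSum-cong []       eq = refl
xorSum-cong (e ∷ es) eq = cong₂ _xor_ (eq (here refl)) (xorSum-cong es (eq ∘ there))

xorSum-∧ : ∀ b c es → xorSum (λ e → b ∧ c e) es ≡ b ∧ xorSum c es
xorSum-∧ b c []       = sym (∧-zeroʳ b)
xorSum-∧ b c (e ∷ es) rewrite xorSum-∧ b c es = sym (∧-distribˡ-xor b (c e) (xorSum c es))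

bd-single : ∀ e p → bd (e ≡ᵉ_) p ≡ (src e ≡ᵖ p) xor (tgt e ≡ᵖ p)
bd-single (hE a b) (zero , zero)   = refl
bd-single (hE a b) (zero , suc y)  = refl
bd-single (hE a b) (suc x , zero)  = cong (((a ≡ᵇ suc x) ∧ (b ≡ᵇ 0)) xor_) (xor-identityʳ _)
bd-single (hE a b) (suc x , suc y) = cong (((a ≡ᵇ suc x) ∧ (b ≡ᵇ suc y)) xor_) (xor-identityʳ _)
bd-single (vE a b) (zero , zero)   = cong (((a ≡ᵇ 0) ∧ (b ≡ᵇ 0)) xor_) (sym (∧-zeroʳ (a ≡ᵇ 0)))
bd-single (vE a b) (zero , suc y)  = cong (((a ≡ᵇ 0) ∧ (b ≡ᵇ suc y)) xor_) (xor-identityʳ _)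
bd-single (vE zero b) (suc x , zero)  = refl
bd-single (vE (suc a) b) (suc x , zero) = cong (((a ≡ᵇ x) ∧ (b ≡ᵇ 0)) xor_) (sym (∧-zeroʳ (a ≡ᵇ x)))
bd-single (vE a b) (suc x , suc y) = cong (((a ≡ᵇ suc x) ∧ (b ≡ᵇ suc y)) xor_) (xor-identityʳ _)
bd-single (dE a b) (zero , zero)   = refl
bd-single (dE a b) (zero , suc y)  = refl
bd-single (dE a b) (suc x , zero)  = cong (((a ≡ᵇ suc x) ∧ (b ≡ᵇ 0)) xor_) (sym (∧-zeroʳ (a ≡ᵇ x)))
bd-single (dE a b) (suc x , suc y) = cong (((a ≡ᵇ suc x) ∧ (b ≡ᵇ suc y)) xor_) (xor-identityʳ _)

-- On the edges at `p` the chain `c` agrees with `c e` times the single edge `e`, whose degree at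
-- `p` is one.
lone-edge : ∀ {c e p q} → Joins e p q → bd c p ≡ false →
            (∀ {e′} → e′ ∈ inc p → e′ ≢ e → c e′ ≡ false) → c e ≡ false
lone-edge {c} {e} {p} {q} j bd0 off = trans (sym c-ends) (trans (cong (c e ∧_) ends≡) (trans eq bd0))
  where
  agree : ∀ {e′} → e′ ∈ inc p → (c e ∧ (e ≡ᵉ e′)) ≡ c e′
  agree {e′} i with e ≡ᵉ e′ in eq
  ... | true  with refl ← ≡ᵉ-sound e e′ eq = ∧-comm (c e) true
  ... | false = trans (∧-zeroʳ (c e)) (sym (off i λ { refl → true≢false (≡ᵉ-refl e) eq }))
  ends≡ : ((src e ≡ᵖ p) xor (tgt e ≡ᵖ p)) ≡ bd (e ≡ᵉ_) p
  ends≡ = sym (bd-single e p)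
  eq : c e ∧ bd (e ≡ᵉ_) p ≡ bd c p
  eq = trans (sym (xorSum-∧ (c e) (e ≡ᵉ_) (inc p))) (xorSum-cong (inc p) agree)
  one-end : ∀ {q} → Joins e p q → ((src e ≡ᵖ p) xor (tgt e ≡ᵖ p)) ≡ true
  one-end (inj₁ (refl , refl))
    rewrite ≡ᵖ-refl (src e) | ≡ᵖ-off (λ eq → src≢tgt e (sym eq)) = refl
  one-end (inj₂ (refl , refl))
    rewrite ≡ᵖ-refl (tgt e) | ≡ᵖ-off (src≢tgt e) = refl
  c-ends : c e ∧ ((src e ≡ᵖ p) xor (tgt e ≡ᵖ p)) ≡ c e
  c-ends = trans (cong (c e ∧_) (one-end j)) (∧-comm (c e) true)

-- Each face at `p` is a side of exactly two edges at `p` and cancels; faces outside the quarter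
-- plane count as false.
even : ∀ D → Grounded D → ∀ p → bd (∂ D) p ≡ false
even D (g , h) (zero , zero) rewrite g 0 | h 0 =
  solve 2 (λ a e → (a :+ con false) :+ (e :+ ((a :+ e) :+ con false)) := con false) refl
    (D (Lo 1 0)) (D (Up 0 1))
  where open xor-∧-Solver
even D (g , h) (zero , suc y) rewrite g (suc y) | g y =
  solve 3 (λ a b e → (a :+ b) :+ (e :+ ((a :+ e) :+ (b :+ con false))) := con false) refl
    (D (Lo 1 (suc y))) (D (Up 0 (suc y))) (D (Up 0 (suc (suc y))))
  where open xor-∧-Solver
even D (g , h) (suc x , zero) rewrite h (suc x) | h x =
  solve 3 (λ a c e → (a :+ con false) :+ ((c :+ e) :+ ((a :+ e) :+ ((c :+ con false) :+ con false))) := con false) refl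
    (D (Lo (suc (suc x)) 0)) (D (Lo (suc x) 0)) (D (Up (suc x) 1))
  where open xor-∧-Solver
even D (g , h) (suc x , suc y) =
  solve 6 (λ a b c e f k → (a :+ b) :+ ((c :+ e) :+ ((a :+ e) :+ ((c :+ f) :+ ((k :+ b) :+ ((k :+ f) :+ con false)))))
             := con false) refl
    (D (Lo (suc (suc x)) (suc y))) (D (Up (suc x) (suc y))) (D (Lo (suc x) (suc y)))
    (D (Up (suc x) (suc (suc y)))) (D (Up x (suc y))) (D (Lo (suc x) y))
  where open xor-∧-Solver

-- Closed chains bound exactly one region

fillUp : Chain → ℕ → ℕ → Bool
fillUp c x zero    = false
fillUp c x (suc y) = (fillUp c x y xor c (hE x y)) xor c (dE x y)

-- Parity of the edges of `c` that are crossed on the way up the column from the axis to the face.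
fill : Chain → Region
fill c (Up x y)       = fillUp c x y
fill c (Lo zero y)    = false
fill c (Lo (suc x) y) = fillUp c x y xor c (hE x y)

fill-grounded : ∀ c → Grounded (fill c)
fill-grounded c = (λ _ → refl) , (λ _ → refl)

-- Horizontal and diagonal edges are the ones crossed in the columns, so only vertical edges need
-- `closed`: each follows from the one below it by evenness at their common point.
∂-fill : ∀ c → (∀ p → bd c p ≡ false) → ∀ e → ∂ (fill c) e ≡ c e
∂-fill c closed (hE x y) = xor-cancel (fillUp c x y) (c (hE x y))
∂-fill c closed (dE x y) = xor-cancelˡ (fillUp c x y xor c (hE x y)) (c (dE x y))
∂-fill c closed (vE zero zero) =
  trans (sym (solve 3 (λ h v d → (h :+ (v :+ (d :+ con false))) :+ v := con false :+ ((con false :+ h) :+ d)) refl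
           (c (hE 0 0)) (c (vE 0 0)) (c (dE 0 0))))
        (cong (_xor c (vE 0 0)) (closed (0 , 0)))
  where open xor-∧-Solver
∂-fill c closed (vE zero (suc y)) =
  trans (cong (λ b → (b xor c (hE 0 (suc y))) xor c (dE 0 (suc y))) (∂-fill c closed (vE zero y)))
  (trans (sym (solve 4 (λ h v d v′ → (h :+ (v :+ (d :+ (v′ :+ con false)))) :+ v := (v′ :+ h) :+ d) refl
           (c (hE 0 (suc y))) (c (vE 0 (suc y))) (c (dE 0 (suc y))) (c (vE 0 y))))
        (cong (_xor c (vE 0 (suc y))) (closed (0 , suc y))))
  where open xor-∧-Solver
∂-fill c closed (vE (suc x) zero) =
  trans (sym (solve 4 (λ h v d h′ → (h :+ (v :+ (d :+ (h′ :+ con false)))) :+ v := (con false :+ h′) :+ ((con false :+ h) :+ d)) refl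
           (c (hE (suc x) 0)) (c (vE (suc x) 0)) (c (dE (suc x) 0)) (c (hE x 0))))
        (cong (_xor c (vE (suc x) 0)) (closed (suc x , 0)))
  where open xor-∧-Solver
∂-fill c closed (vE (suc x) (suc y)) =
  trans (solve 6 (λ a b d′ h′ h d → ((a :+ d′) :+ h′) :+ ((b :+ h) :+ d) := (a :+ b) :+ (d′ :+ (h′ :+ (h :+ d)))) refl
           (fillUp c x y xor c (hE x y)) (fillUp c (suc x) (suc y)) (c (dE x y))
           (c (hE x (suc y))) (c (hE (suc x) (suc y))) (c (dE (suc x) (suc y))))
  (trans (cong (_xor (c (dE x y) xor (c (hE x (suc y)) xor (c (hE (suc x) (suc y)) xor c (dE (suc x) (suc y))))))
           (∂-fill c closed (vE (suc x) y)))
  (trans (sym (solve 6 (λ h v d h′ v′ d′ →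
              (h :+ (v :+ (d :+ (h′ :+ (v′ :+ (d′ :+ con false)))))) :+ v := v′ :+ (d′ :+ (h′ :+ (h :+ d)))) refl
           (c (hE (suc x) (suc y))) (c (vE (suc x) (suc y))) (c (dE (suc x) (suc y)))
           (c (hE x (suc y))) (c (vE (suc x) y)) (c (dE x y))))
         (cong (_xor c (vE (suc x) (suc y))) (closed (suc x , suc y)))))
  where open xor-∧-Solver

flat : ∀ D → Grounded D → (∀ e → ∂ D e ≡ false) → ∀ f → D f ≡ false
flat D (g , h) z = λ { (Up x y) → u x y ; (Lo zero y) → g y ; (Lo (suc x) y) → trans (xor-false⇒≡ {D (Lo (suc x) y)} (z (hE x y))) (u x y) }
  where
  u : ∀ x y → D (Up x y) ≡ false
  u x zero    = h x
  u x (suc y) = trans (sym (xor-false⇒≡ {D (Lo (suc x) y)} (z (dE x y))))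
                      (trans (xor-false⇒≡ {D (Lo (suc x) y)} (z (hE x y))) (u x y))

-- Neighbouring faces around `p` are separated by an edge at `p`, so the value is constant around
-- `p`. On the axes outer faces take part and force it to be false.
fan : ∀ D → Grounded D → ∀ p → (∀ {e} → e ∈ inc p → ∂ D e ≡ false) →
      ∃ λ b → ∀ {e} → e ∈ inc p → D (lo e) ≡ b × D (up e) ≡ b
fan D (g , h) (zero , zero) z = false , λ
  { (here refl) → l , h 0 ; (there (here refl)) → g 0 , u ; (there (there (here refl))) → l , u }
  where
  l = trans (xor-false⇒≡ (z (here refl))) (h 0)
  u = trans (sym (xor-false⇒≡ (z (there (here refl))))) (g 0)
fan D (g , h) (zero , suc y) z = false , λ
  { (here refl) → l , trans (sym (xor-false⇒≡ (z (here refl)))) l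
  ; (there (here refl)) → g _ , u
  ; (there (there (here refl))) → l , u
  ; (there (there (there (here refl)))) → g _ , trans (sym (xor-false⇒≡ (z (there (there (there (here refl))))))) (g _) }
  where
  u = trans (sym (xor-false⇒≡ (z (there (here refl))))) (g (suc y))
  l = trans (xor-false⇒≡ (z (there (there (here refl))))) u
fan D (g , h) (suc x , zero) z = false , λ
  { (here refl) → l , h _
  ; (there (here refl)) → trans (xor-false⇒≡ (z (there (here refl)))) u , u
  ; (there (there (here refl))) → l , u
  ; (there (there (there (here refl)))) → trans (xor-false⇒≡ (z (there (there (there (here refl)))))) (h _) , h _ }
  where
  l = trans (xor-false⇒≡ (z (here refl))) (h (suc x))
  u = trans (sym (xor-false⇒≡ (z (there (there (here refl)))))) l
fan D (g , h) (suc x , suc y) z = D (Up (suc x) (suc y)) , λ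
  { (here refl) → a , refl
  ; (there (here refl)) → c , e
  ; (there (there (here refl))) → a , e
  ; (there (there (there (here refl)))) → c , f
  ; (there (there (there (there (here refl))))) → k , refl
  ; (there (there (there (there (there (here refl)))))) → k , f }
  where
  a = xor-false⇒≡ (z (here refl))
  e = trans (sym (xor-false⇒≡ (z (there (there (here refl)))))) a
  c = trans (xor-false⇒≡ (z (there (here refl)))) e
  f = trans (sym (xor-false⇒≡ (z (there (there (there (here refl))))))) c
  k = xor-false⇒≡ (z (there (there (there (there (here refl))))))

Side : Face → Edge → Set
Side F e = F ≡ lo e ⊎ F ≡ up e

record Apex (F : Face) (e : Edge) (a b : Pt) : Set where
  field
    c       : Pt
    e₁ e₂   : Edge
    joins₁  : Joins e₁ a c
    joins₂  : Joins e₂ b c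
    e≢e₁    : e ≢ e₁
    e≢e₂    : e ≢ e₂
    side₁   : Side F e₁
    side₂   : Side F e₂
    ∂-apex  : ∀ e′ → ∂ (F ≡ᶠ_) e′ ≡ ((e ≡ᵉ e′) xor (e₁ ≡ᵉ e′)) xor (e₂ ≡ᵉ e′)

Apex-swap : ∀ {F e a b} → Apex F e a b → Apex F e b a
Apex-swap {F} {e} t = record
  { joins₁ = joins₂ ; joins₂ = joins₁ ; e≢e₁ = e≢e₂ ; e≢e₂ = e≢e₁ ; side₁ = side₂ ; side₂ = side₁
  ; ∂-apex = λ e′ → trans (∂-apex e′) (swap-last (e ≡ᵉ e′) (e₁ ≡ᵉ e′) (e₂ ≡ᵉ e′)) }
  where
  open Apex t
  swap-last : ∀ x y z → (x xor y) xor z ≡ (x xor z) xor y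
  swap-last = solve 3 (λ x y z → (x :+ y) :+ z := (x :+ z) :+ y) refl
    where open xor-∧-Solver

∂-lower : ∀ x y e → ∂ (Lo (suc x) y ≡ᶠ_) e ≡ ((hE x y ≡ᵉ e) xor (vE (suc x) y ≡ᵉ e)) xor (dE x y ≡ᵉ e)
∂-lower x y (hE a b) = cong (_xor false) (sym (xor-identityʳ ((x ≡ᵇ a) ∧ (y ≡ᵇ b))))
∂-lower x y (vE a b) = refl
∂-lower x y (dE a b) = xor-identityʳ _

∂-upper : ∀ x y e → ∂ (Up x (suc y) ≡ᶠ_) e ≡ ((vE x y ≡ᵉ e) xor (hE x (suc y) ≡ᵉ e)) xor (dE x y ≡ᵉ e)
∂-upper x y (hE a zero) rewrite ∧-zeroʳ (x ≡ᵇ a) = refl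
∂-upper x y (hE a (suc b)) = sym (xor-identityʳ _)
∂-upper x y (vE a b) = sym (trans (xor-identityʳ _) (xor-identityʳ _))
∂-upper x y (dE a b) = refl

apex-src : ∀ {D F} e → Grounded D → D F ≡ true → Side F e → Apex F e (src e) (tgt e)
apex-src (hE x y) g d (inj₁ refl) = record
  { c = suc x , suc y ; e₁ = dE x y ; e₂ = vE (suc x) y
  ; joins₁ = inj₁ (refl , refl) ; joins₂ = inj₁ (refl , refl) ; e≢e₁ = λ () ; e≢e₂ = λ ()
  ; side₁ = inj₁ refl ; side₂ = inj₁ refl
  ; ∂-apex = λ e → trans (∂-lower x y e) (xor-swap (hE x y ≡ᵉ e) (vE (suc x) y ≡ᵉ e) (dE x y ≡ᵉ e)) }
  where
  open xor-∧-Solver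
  xor-swap = solve 3 (λ h v d → (h :+ v) :+ d := (h :+ d) :+ v) refl
apex-src (hE x zero) g d (inj₂ refl) = ⊥-elim (true≢false d (proj₂ g x))
apex-src (hE x (suc y)) g d (inj₂ refl) = record
  { c = x , y ; e₁ = vE x y ; e₂ = dE x y
  ; joins₁ = inj₂ (refl , refl) ; joins₂ = inj₂ (refl , refl) ; e≢e₁ = λ () ; e≢e₂ = λ ()
  ; side₁ = inj₂ refl ; side₂ = inj₂ refl
  ; ∂-apex = λ e → trans (∂-upper x y e) (xor-swap (vE x y ≡ᵉ e) (hE x (suc y) ≡ᵉ e) (dE x y ≡ᵉ e)) }
  where
  open xor-∧-Solver
  xor-swap = solve 3 (λ v h d → (v :+ h) :+ d := (h :+ v) :+ d) refl
apex-src (vE zero y) g d (inj₁ refl) = ⊥-elim (true≢false d (proj₁ g y))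
apex-src (vE (suc x) y) g d (inj₁ refl) = record
  { c = x , y ; e₁ = hE x y ; e₂ = dE x y
  ; joins₁ = inj₂ (refl , refl) ; joins₂ = inj₂ (refl , refl) ; e≢e₁ = λ () ; e≢e₂ = λ ()
  ; side₁ = inj₁ refl ; side₂ = inj₁ refl
  ; ∂-apex = λ e → trans (∂-lower x y e) (xor-swap (hE x y ≡ᵉ e) (vE (suc x) y ≡ᵉ e) (dE x y ≡ᵉ e)) }
  where
  open xor-∧-Solver
  xor-swap = solve 3 (λ h v d → (h :+ v) :+ d := (v :+ h) :+ d) refl
apex-src (vE x y) g d (inj₂ refl) = record
  { c = suc x , suc y ; e₁ = dE x y ; e₂ = hE x (suc y)
  ; joins₁ = inj₁ (refl , refl) ; joins₂ = inj₁ (refl , refl) ; e≢e₁ = λ () ; e≢e₂ = λ ()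
  ; side₁ = inj₂ refl ; side₂ = inj₂ refl
  ; ∂-apex = λ e → trans (∂-upper x y e) (xor-swap (vE x y ≡ᵉ e) (hE x (suc y) ≡ᵉ e) (dE x y ≡ᵉ e)) }
  where
  open xor-∧-Solver
  xor-swap = solve 3 (λ v h d → (v :+ h) :+ d := (v :+ d) :+ h) refl
apex-src (dE x y) g d (inj₁ refl) = record
  { c = suc x , y ; e₁ = hE x y ; e₂ = vE (suc x) y
  ; joins₁ = inj₁ (refl , refl) ; joins₂ = inj₂ (refl , refl) ; e≢e₁ = λ () ; e≢e₂ = λ ()
  ; side₁ = inj₁ refl ; side₂ = inj₁ refl
  ; ∂-apex = λ e → trans (∂-lower x y e) (xor-swap (hE x y ≡ᵉ e) (vE (suc x) y ≡ᵉ e) (dE x y ≡ᵉ e)) }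
  where
  open xor-∧-Solver
  xor-swap = solve 3 (λ h v d → (h :+ v) :+ d := (d :+ h) :+ v) refl
apex-src (dE x y) g d (inj₂ refl) = record
  { c = x , suc y ; e₁ = vE x y ; e₂ = hE x (suc y)
  ; joins₁ = inj₁ (refl , refl) ; joins₂ = inj₂ (refl , refl) ; e≢e₁ = λ () ; e≢e₂ = λ ()
  ; side₁ = inj₂ refl ; side₂ = inj₂ refl
  ; ∂-apex = λ e → trans (∂-upper x y e) (xor-swap (vE x y ≡ᵉ e) (hE x (suc y) ≡ᵉ e) (dE x y ≡ᵉ e)) }
  where
  open xor-∧-Solver
  xor-swap = solve 3 (λ v h d → (v :+ h) :+ d := (d :+ v) :+ h) refl

apex : ∀ {D F e a b} → Grounded D → D F ≡ true → Side F e → Joins e a b → Apex F e a b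
apex {D} {e = e} g d s (inj₁ (refl , refl)) = apex-src {D} e g d s
apex {D} {e = e} g d s (inj₂ (refl , refl)) = Apex-swap (apex-src {D} e g d s)

-- Regions between two paths

_≟ᵉ_ : (e f : Edge) → Dec (e ≡ f)
e ≟ᵉ f with e ≡ᵉ f in eq
... | true  = yes (≡ᵉ-sound e f eq)
... | false = no λ { refl → true≢false (≡ᵉ-refl e) eq }

_≟ᵖ_ : (p q : Pt) → Dec (p ≡ q)
p ≟ᵖ q with p ≡ᵖ q in eq
... | true  = yes (≡ᵖ-sound p q eq)
... | false = no λ { refl → true≢false (≡ᵖ-refl p) eq }

open DecMem _≟ᵉ_ using () renaming (_∈?_ to _∈ᵉ?_)
open DecMem _≟ᵖ_ using () renaming (_∈?_ to _∈ᵖ?_)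

origin : Pt
origin = 0 , 0

data Path : Pt → Set where
  end  : Path origin
  step : ∀ {p q} (e : Edge) → Joins e p q → Path q → Path p

verts : ∀ {p} → Path p → List Pt
verts end              = origin ∷ []
verts (step {p} _ _ γ) = p ∷ verts γ

edges : ∀ {p} → Path p → List Edge
edges end          = []
edges (step e _ γ) = e ∷ edges γ

chain : ∀ {p} → Path p → Chain
chain end          e′ = false
chain (step e _ γ) e′ = (e ≡ᵉ e′) xor chain γ e′

Simple : ∀ {p} → Path p → Set
Simple end              = ⊤
Simple (step {p} _ _ γ) = p ∉ verts γ × Simple γ

tip∈verts : ∀ {p} (γ : Path p) → p ∈ verts γ
tip∈verts end          = here refl
tip∈verts (step _ _ _) = here refl

origin∈verts : ∀ {p} (γ : Path p) → origin ∈ verts γ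
origin∈verts end          = here refl
origin∈verts (step _ _ γ) = there (origin∈verts γ)

ends∈verts : ∀ {p e v w} (γ : Path p) → e ∈ edges γ → Joins e v w → v ∈ verts γ
ends∈verts (step _ j γ) (here refl) k with Joins-ends k j
... | inj₁ refl = here refl
... | inj₂ refl = there (tip∈verts γ)
ends∈verts (step _ _ γ) (there i) k = there (ends∈verts γ i k)

inc∈verts : ∀ {p e v} (γ : Path p) → e ∈ edges γ → e ∈ inc v → v ∈ verts γ
inc∈verts γ i k = ends∈verts γ i (proj₂ (inc⇒Joins _ k))

vert-edge : ∀ {p v} (γ : Path p) → v ∈ verts γ → v ≡ origin ⊎ ∃ λ e → e ∈ edges γ × e ∈ inc v
vert-edge end          (here refl) = inj₁ refl
vert-edge (step e j γ) (here refl) = inj₂ (e , here refl , Joins⇒inc j)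
vert-edge (step e j γ) (there i) with vert-edge γ i
... | inj₁ eq            = inj₁ eq
... | inj₂ (e′ , k , l) = inj₂ (e′ , there k , l)

chain-∉ : ∀ {p e} (γ : Path p) → e ∉ edges γ → chain γ e ≡ false
chain-∉ end           i = refl
chain-∉ {e = e} (step e′ j γ) i rewrite ≡ᵉ-off {e′} {e} (λ { refl → i (here refl) }) = chain-∉ γ (i ∘ there)

chain-∈ : ∀ {p e} (γ : Path p) → Simple γ → e ∈ edges γ → chain γ e ≡ true
chain-∈ (step e j γ) (p∉ , s) (here refl)
  rewrite ≡ᵉ-refl e | chain-∉ {e = e} γ (λ i → p∉ (ends∈verts γ i j)) = refl
chain-∈ {e = e} (step e′ j γ) (p∉ , s) (there i)
  rewrite ≡ᵉ-off {e′} {e} (λ { refl → p∉ (ends∈verts γ i j) }) = chain-∈ γ s i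

bd-joins : ∀ {e p q} → Joins e p q → ∀ v → bd (e ≡ᵉ_) v ≡ (p ≡ᵖ v) xor (q ≡ᵖ v)
bd-joins {e} (inj₁ (refl , refl)) v = bd-single e v
bd-joins {e} (inj₂ (refl , refl)) v = trans (bd-single e v) (Bool.xor-comm (src e ≡ᵖ v) (tgt e ≡ᵖ v))

bd-chain : ∀ {p} (γ : Path p) v → bd (chain γ) v ≡ (p ≡ᵖ v) xor (origin ≡ᵖ v)
bd-chain end v = trans (zeros (inc v)) (sym (xor-same (origin ≡ᵖ v)))
  where
  zeros : ∀ es → xorSum (λ _ → false) es ≡ false
  zeros []       = refl
  zeros (_ ∷ es) = zeros es
bd-chain (step {p} {q} e j γ) v
  rewrite xorSum-xor (e ≡ᵉ_) (chain γ) (inc v) | bd-joins j v | bd-chain γ v =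
  solve 3 (λ p q o → (p :+ q) :+ (q :+ o) := p :+ o) refl (p ≡ᵖ v) (q ≡ᵖ v) (origin ≡ᵖ v)
  where open xor-∧-Solver

-- A simple path carries no cycle: only one of its edges meets the tip, evenness of `∂ ψ` clears
-- that edge, and the rest of the path follows in the same way.
forest : ∀ {p ψ} (γ : Path p) → Simple γ → Grounded ψ → (∀ {e} → e ∉ edges γ → ∂ ψ e ≡ false) → ∀ f → ψ f ≡ false
forest {ψ = ψ} end s g off = flat ψ g λ e → off λ ()
forest {ψ = ψ} (step {p} e j γ) (p∉ , s) g off = forest γ s g off′
  where
  first : ∂ ψ e ≡ false
  first = lone-edge {c = ∂ ψ} j (even ψ g p) λ i ne → off λ
    { (here eq) → ne eq ; (there k) → p∉ (inc∈verts γ k i) }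
  off′ : ∀ {e′} → e′ ∉ edges γ → ∂ ψ e′ ≡ false
  off′ {e′} i with e′ ≟ᵉ e
  ... | yes refl = first
  ... | no ne    = off λ { (here eq) → ne eq ; (there k) → i k }

-- `p` is an interior point of `D`: every face around `p` is a side of some edge at `p`.
record Q (D : Region) (p : Pt) : Set where
  constructor mkQ
  field around : ∀ {e} → e ∈ inc p → D (lo e) ≡ true × D (up e) ≡ true
open Q public

-- The closed region. The paths are added explicitly, since `D` need not have a face beside an edge
-- that both of them use.
Cl : Region → ∀ {a b} → Path a → Path b → Edge → Set
Cl D γ γ′ e = (e ∈ edges γ ⊎ e ∈ edges γ′) ⊎ (D (lo e) ≡ true ⊎ D (up e) ≡ true)

-- An edge used by both paths cancels in the boundary of `D`; this excludes that it then runs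
-- through the inside.
Thin : Region → ∀ {a} → Path a → Set
Thin D γ = ∀ {e} → e ∈ edges γ → D (lo e) ≡ true → D (up e) ≡ true → ⊥

-- This is how it is expressed that the complement of the region is connected.
Maximal : Region → ∀ {a b} → Path a → Path b → Set
Maximal D γ γ′ = ∀ φ → Grounded φ → (∀ {e} → ∂ φ e ≡ true → Cl D γ γ′ e) → ∀ {f} → φ f ≡ true → D f ≡ true

record Between (D : Region) {a b} (γ : Path a) (γ′ : Path b) : Set where
  field
    grounded : Grounded D
    thin     : Thin D γ
    thin′    : Thin D γ′
    simple   : Simple γ
    simple′  : Simple γ′
    maximal  : Maximal D γ γ′

record Closed (D : Region) {a b} (γ : Path a) (γ′ : Path b) (e : Edge) : Set where
  field
    between : Between D γ γ′
    joins   : Joins e a b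
    bdry    : ∀ e′ → ∂ D e′ ≡ (chain γ e′ xor chain γ′ e′) xor (e ≡ᵉ e′)
  open Between between public

-- A closing edge on one of the paths could cancel. When it is fresh it belongs to the boundary, so
-- exactly one of its sides is a face of `D`.
record Disc (D : Region) {a b} (γ : Path a) (γ′ : Path b) (e : Edge) : Set where
  field
    closed  : Closed D γ γ′ e
    fresh   : e ∉ edges γ
    fresh′  : e ∉ edges γ′
  open Closed closed public

Between-swap : ∀ {D a b} {γ : Path a} {γ′ : Path b} → Between D γ γ′ → Between D γ′ γ
Between-swap {D} {γ = γ} {γ′} d = record
  { grounded = grounded ; thin = thin′ ; thin′ = thin ; simple = simple′ ; simple′ = simple
  ; maximal = λ φ g c → maximal φ g λ {e} eq → swap (c {e} eq) }
  where
  open Between d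
  swap : ∀ {e} → Cl D γ′ γ e → Cl D γ γ′ e
  swap (inj₁ (inj₁ i)) = inj₁ (inj₂ i)
  swap (inj₁ (inj₂ i)) = inj₁ (inj₁ i)
  swap (inj₂ s)        = inj₂ s

Closed-swap : ∀ {D a b e} {γ : Path a} {γ′ : Path b} → Closed D γ γ′ e → Closed D γ′ γ e
Closed-swap {e = e} {γ} {γ′} d = record
  { between = Between-swap between ; joins = Joins-sym joins
  ; bdry = λ e′ → trans (bdry e′) (cong (_xor (e ≡ᵉ e′)) (Bool.xor-comm (chain γ e′) (chain γ′ e′))) }
  where open Closed d

Disc-swap : ∀ {D a b e} {γ : Path a} {γ′ : Path b} → Disc D γ γ′ e → Disc D γ′ γ e
Disc-swap d = record { closed = Closed-swap (Disc.closed d) ; fresh = Disc.fresh′ d ; fresh′ = Disc.fresh d }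

origin∉Q : ∀ D → Grounded D → ¬ Q D origin
origin∉Q D g q = true≢false (proj₂ (around q (here refl))) (proj₂ g 0)

-- A vertex of the path is the origin, which has a face outside the quarter plane, or an end of a
-- path edge, which would have `D` on both sides.
Thin⇒∉ : ∀ D {a v} {γ : Path a} → Grounded D → Thin D γ → Q D v → v ∉ verts γ
Thin⇒∉ D {γ = γ} g t q i with vert-edge γ i
... | inj₁ refl        = origin∉Q D g q
... | inj₂ (e , k , l) = t k (proj₁ (around q l)) (proj₂ (around q l))

closed-off : ∀ {D a b e v} {γ : Path a} {γ′ : Path b} → Closed D γ γ′ e →
             v ∉ verts γ → v ∉ verts γ′ → ∀ {e′} → e′ ∈ inc v → ∂ D e′ ≡ false
closed-off {a = a} {b} {e} {v} {γ} {γ′} d v∉ v∉′ {e′} i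
  rewrite Closed.bdry d e′
  | chain-∉ {e = e′} γ (λ k → v∉ (inc∈verts γ k i)) | chain-∉ {e = e′} γ′ (λ k → v∉′ (inc∈verts γ′ k i)) =
  ≡ᵉ-off {e} {e′} λ { refl → bad (Joins-ends (proj₂ (inc⇒Joins v i)) (Closed.joins d)) }
  where
  bad : v ≡ a ⊎ v ≡ b → ⊥
  bad (inj₁ refl) = v∉ (tip∈verts γ)
  bad (inj₂ refl) = v∉′ (tip∈verts γ′)

-- Off the paths no boundary edge ends at `w`, so by `fan` all faces at `w` agree with those beside
-- the edge to `v`.
Q-spread : ∀ {D a b e v w e′} {γ : Path a} {γ′ : Path b} → Closed D γ γ′ e →
           Joins e′ v w → Q D v → w ∉ verts γ → w ∉ verts γ′ → Q D w
Q-spread {D} {w = w} d j q w∉ w∉′ with fan D (Closed.grounded d) w (closed-off d w∉ w∉′)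
... | b , all≡ = mkQ λ i → trans (proj₁ (all≡ i)) b≡true , trans (proj₂ (all≡ i)) b≡true
  where
  b≡true : b ≡ true
  b≡true = trans (sym (proj₁ (all≡ (Joins⇒inc (Joins-sym j))))) (proj₁ (around q (Joins⇒inc j)))

-- Cutting a region along a third path

Sides : Edge → Face → Face → Set
Sides e f g = (f ≡ lo e × g ≡ up e) ⊎ (f ≡ up e × g ≡ lo e)

∂-sides : ∀ {e f g} D → Sides e f g → D f xor D g ≡ ∂ D e
∂-sides D (inj₁ (refl , refl)) = refl
∂-sides {e} D (inj₂ (refl , refl)) = Bool.xor-comm (D (up e)) (D (lo e))

opposite : ∀ {F e} → Side F e → ∃ λ G → Sides e F G
opposite (inj₁ refl) = _ , inj₁ (refl , refl)
opposite (inj₂ refl) = _ , inj₂ (refl , refl)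

Side-Cl : ∀ {D a b F e} {γ : Path a} {γ′ : Path b} → Side F e → D F ≡ true → Cl D γ γ′ e
Side-Cl (inj₁ refl) d = inj₂ (inj₁ d)
Side-Cl (inj₂ refl) d = inj₂ (inj₂ d)

Thin-sides : ∀ {D a e f g} {γ : Path a} → Thin D γ → e ∈ edges γ → Sides e f g → D f ≡ true → D g ≡ true → ⊥
Thin-sides t i (inj₁ (refl , refl)) x y = t i x y
Thin-sides t i (inj₂ (refl , refl)) x y = t i y x

other-side : ∀ {e f g F} → Sides e f g → Side F e → g ≢ F → f ≡ F
other-side (inj₁ (refl , refl)) (inj₁ eq) ne = sym eq
other-side (inj₁ (refl , refl)) (inj₂ eq) ne = ⊥-elim (ne (sym eq))
other-side (inj₂ (refl , refl)) (inj₁ eq) ne = ⊥-elim (ne (sym eq))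
other-side (inj₂ (refl , refl)) (inj₂ eq) ne = sym eq

xor-true : ∀ {a b} → a xor b ≡ true → (a ≡ true × b ≡ false) ⊎ (a ≡ false × b ≡ true)
xor-true {true}  {false} _ = inj₁ (refl , refl)
xor-true {false} {true}  _ = inj₂ (refl , refl)

-- The piece between `γa` and `γ`, closed by the side `e₁` of the triangle `F`. The other piece is
-- the same construction with `γa` and `γb` exchanged.
module Split {D a b e} {γa : Path a} {γb : Path b} (disc : Disc D γa γb e)
             {F} (F∈D : D F ≡ true) (F-side : Side F e) (t : Apex F e a b)
             (γ : Path (Apex.c t)) (γ-simple : Simple γ)
             (γ⊆ : ∀ {e′} → e′ ∈ edges γ → Cl D γa γb e′) (e∉γ : e ∉ edges γ) where
  open Disc disc
  open Apex t

  loop : Chain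
  loop e′ = (chain γa e′ xor chain γ e′) xor (e₁ ≡ᵉ e′)

  loop-closed : ∀ v → bd loop v ≡ false
  loop-closed v
    rewrite xorSum-xor (λ e′ → chain γa e′ xor chain γ e′) (e₁ ≡ᵉ_) (inc v)
          | xorSum-xor (chain γa) (chain γ) (inc v)
          | bd-chain γa v | bd-chain γ v | bd-joins joins₁ v =
    solve 3 (λ a c o → ((a :+ o) :+ (c :+ o)) :+ (a :+ c) := con false) refl
      (a ≡ᵖ v) (c ≡ᵖ v) (origin ≡ᵖ v)
    where open xor-∧-Solver

  D₁ : Region
  D₁ = fill loop

  ∂D₁ : ∀ e′ → ∂ D₁ e′ ≡ loop e′
  ∂D₁ = ∂-fill loop loop-closed

  F′ : Face
  F′ = proj₁ (opposite F-side)

  sides : Sides e F F′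
  sides = proj₂ (opposite F-side)

  F′∉D : D F′ ≡ false
  F′∉D with xor-true (trans (∂-sides D sides) ∂e)
    where
    ∂e : ∂ D e ≡ true
    ∂e rewrite bdry e | chain-∉ γa fresh | chain-∉ γb fresh′ = ≡ᵉ-refl e
  ... | inj₁ (_ , eq) = eq
  ... | inj₂ (eq , _) = ⊥-elim (true≢false F∈D eq)

  loop-cases : ∀ {e′} → loop e′ ≡ true → (e′ ∈ edges γa ⊎ e′ ∈ edges γ) ⊎ e₁ ≡ e′
  loop-cases {e′} eq with e′ ∈ᵉ? edges γa | e′ ∈ᵉ? edges γ
  ... | yes i | _     = inj₁ (inj₁ i)
  ... | no _  | yes i = inj₁ (inj₂ i)
  ... | no i  | no k rewrite chain-∉ γa i | chain-∉ γ k = inj₂ (≡ᵉ-sound e₁ e′ eq)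

  -- The place where maximality acts as a Jordan curve theorem: the loop lies in the closure of `D`,
  -- hence so does what it encloses.
  D₁⊆D : ∀ {f} → D₁ f ≡ true → D f ≡ true
  D₁⊆D = maximal D₁ (fill-grounded loop) λ {e′} eq → cl (loop-cases (trans (sym (∂D₁ e′)) eq))
    where
    cl : ∀ {e′} → (e′ ∈ edges γa ⊎ e′ ∈ edges γ) ⊎ e₁ ≡ e′ → Cl D γa γb e′
    cl (inj₁ (inj₁ i)) = inj₁ (inj₁ i)
    cl (inj₁ (inj₂ i)) = γ⊆ i
    cl (inj₂ refl)     = Side-Cl {γ = γa} {γb} side₁ F∈D

  -- The loop avoids `e`, so the two sides of `e` have the same value, and `F′` lies outside `D`.
  F∉D₁ : D₁ F ≡ false
  F∉D₁ = trans (xor-false⇒≡ {D₁ F} {D₁ F′} (trans (∂-sides D₁ sides) (trans (∂D₁ e) ∂e)))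
               (not-true λ eq → true≢false (D₁⊆D eq) F′∉D)
    where
    ∂e : loop e ≡ false
    ∂e rewrite chain-∉ γa fresh | chain-∉ γ e∉γ = ≡ᵉ-off (λ eq → e≢e₁ (sym eq))

  thinₐ : Thin D₁ γa
  thinₐ i x y = thin i (D₁⊆D x) (D₁⊆D y)

  -- An edge of `γ` that survives in the loop separates `D₁` from its complement. One that cancels
  -- lies on `γa`, or it is `e₁`, which has the excluded face `F` as a side.
  thin-γ : Thin D₁ γ
  thin-γ {e′} i x y with e′ ∈ᵉ? edges γa | e₁ ≟ᵉ e′
  ... | yes k | _        = thinₐ k x y
  ... | no k  | yes refl = both side₁
    where
    both : Side F e₁ → ⊥
    both (inj₁ eq) = true≢false x (trans (cong D₁ (sym eq)) F∉D₁)
    both (inj₂ eq) = true≢false y (trans (cong D₁ (sym eq)) F∉D₁)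
  ... | no k  | no ne    = true≢false (trans (∂D₁ e′) odd) (cong₂ _xor_ x y)
    where
    odd : loop e′ ≡ true
    odd rewrite chain-∉ γa k | chain-∈ γ γ-simple i | ≡ᵉ-off ne = refl

  module _ (φ : Region) (φ-grounded : Grounded φ) (∂φ : ∀ {e′} → ∂ φ e′ ≡ true → Cl D₁ γa γ e′) where
    φ⊆D : ∀ {f} → φ f ≡ true → D f ≡ true
    φ⊆D = maximal φ φ-grounded λ {e′} eq → cl (∂φ {e′} eq)
      where
      cl : ∀ {e′} → Cl D₁ γa γ e′ → Cl D γa γb e′
      cl (inj₁ (inj₁ i)) = inj₁ (inj₁ i)
      cl (inj₁ (inj₂ i)) = γ⊆ i
      cl (inj₂ (inj₁ x)) = inj₂ (inj₁ (D₁⊆D x))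
      cl (inj₂ (inj₂ x)) = inj₂ (inj₂ (D₁⊆D x))

    -- The excess of `φ` over `D₁`. Its boundary turns out to be confined to `γ`, so that `forest`
    -- makes it empty.
    ψ : Region
    ψ f = φ f ∧ not (D₁ f)

    ψ-grounded : Grounded ψ
    ψ-grounded = (λ y → cong (_∧ _) (proj₁ φ-grounded y)) , (λ x → cong (_∧ _) (proj₂ φ-grounded x))

    ψ-true : ∀ {f} → ψ f ≡ true → φ f ≡ true × D₁ f ≡ false
    ψ-true {f} eq with φ f | D₁ f
    ... | true | false = refl , refl

    -- Both `φ` and `D₁` lie in `D`, so `γa`, being thin for `D`, cannot separate `f` from a face of
    -- `D`. What escapes this argument is the edge `e₁`, which may cancel against `γa` in the loop.
    exposed : ∀ {e′ f g} → e′ ∉ edges γ → Sides e′ f g → ψ f ≡ true → ψ g ≡ false → e₁ ≡ e′ × g ≢ F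
    exposed {e′} {f} {g} e′∉ s ψf ψg with ψ-true {f} ψf | D₁ g in D₁g
    ... | φf , D₁f | true with loop-cases {e′} (trans (sym (∂D₁ e′)) (trans (sym (∂-sides D₁ s)) (cong₂ _xor_ D₁f D₁g)))
    ...   | inj₁ (inj₁ i) = ⊥-elim (Thin-sides {γ = γa} thin i s (φ⊆D φf) (D₁⊆D D₁g))
    ...   | inj₁ (inj₂ i) = ⊥-elim (e′∉ i)
    ...   | inj₂ eq       = eq , λ { refl → true≢false D₁g F∉D₁ }
    exposed {e′} {f} {g} e′∉ s ψf ψg | φf , D₁f | false with ∂φ {e′} (trans (sym (∂-sides φ s)) (cong₂ _xor_ φf (trans (sym (∧-identityʳ (φ g))) ψg)))
    ... | inj₁ (inj₂ i) = ⊥-elim (e′∉ i)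
    ... | inj₂ (inj₁ x) = ⊥-elim (inside s x D₁f D₁g)
      where
      inside : Sides e′ f g → D₁ (lo e′) ≡ true → D₁ f ≡ false → D₁ g ≡ false → ⊥
      inside (inj₁ (refl , refl)) x y z = true≢false x y
      inside (inj₂ (refl , refl)) x y z = true≢false x z
    ... | inj₂ (inj₂ x) = ⊥-elim (inside s x D₁f D₁g)
      where
      inside : Sides e′ f g → D₁ (up e′) ≡ true → D₁ f ≡ false → D₁ g ≡ false → ⊥
      inside (inj₁ (refl , refl)) x y z = true≢false x z
      inside (inj₂ (refl , refl)) x y z = true≢false x y
    ... | inj₁ (inj₁ i) = e₁≡ , λ { refl → Thin-sides {γ = γa} thin i s (φ⊆D φf) F∈D }
      where
      parity : loop e′ ≡ false
      parity = trans (sym (∂D₁ e′)) (trans (sym (∂-sides D₁ s)) (cong₂ _xor_ D₁f D₁g))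
      on : ∀ {b} → true xor b ≡ false → b ≡ true
      on {true} _ = refl
      e₁≡ : e₁ ≡ e′
      e₁≡ = ≡ᵉ-sound e₁ e′ (on (trans (cong₂ (λ x y → (x xor y) xor (e₁ ≡ᵉ e′))
              (sym (chain-∈ γa simple i)) (sym (chain-∉ γ e′∉))) parity))

    -- Crossing `e` from `F` leaves `D` and therefore `φ`, and `e` is not the exceptional edge.
    F∉ψ : ψ F ≡ false
    F∉ψ = not-true λ eq → e≢e₁ (sym (proj₁ (exposed e∉γ sides eq
            (not-true λ eq′ → true≢false (φ⊆D (proj₁ (ψ-true {F′} eq′))) F′∉D))))

    ∂ψ : ∀ {e′} → e′ ∉ edges γ → ∂ ψ e′ ≡ false
    ∂ψ {e′} e′∉ = not-true λ eq → cases (xor-true eq)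
      where
      none : ∀ {f g} → Sides e′ f g → ψ f ≡ true → ψ g ≡ false → ⊥
      none s x y with exposed e′∉ s x y
      ... | refl , g≢F with refl ← other-side s side₁ g≢F = true≢false x F∉ψ
      cases : _ → ⊥
      cases (inj₁ (x , y)) = none (inj₁ (refl , refl)) x y
      cases (inj₂ (x , y)) = none (inj₂ (refl , refl)) y x

    φ⊆D₁ : ∀ {f} → φ f ≡ true → D₁ f ≡ true
    φ⊆D₁ {f} x = clash x (forest {ψ = ψ} γ γ-simple ψ-grounded ∂ψ f)
      where
      clash : ∀ {a b} → a ≡ true → a ∧ not b ≡ false → b ≡ true
      clash {true} {true} _ _ = refl

  closed₁ : Closed D₁ γa γ e₁
  closed₁ = record
    { between = record
      { grounded = fill-grounded loop ; thin = thinₐ ; thin′ = thin-γ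
      ; simple = simple ; simple′ = γ-simple ; maximal = φ⊆D₁ }
    ; joins = joins₁ ; bdry = ∂D₁ }

∂-xor : ∀ D D′ e → ∂ (λ f → D f xor D′ f) e ≡ ∂ D e xor ∂ D′ e
∂-xor D D′ e = solve 4 (λ a b c d → (a :+ b) :+ (c :+ d) := (a :+ c) :+ (b :+ d)) refl
  (D (lo e)) (D′ (lo e)) (D (up e)) (D′ (up e))
  where open xor-∧-Solver

module Cut {D a b e} {γa : Path a} {γb : Path b} (disc : Disc D γa γb e)
           {F} (F∈D : D F ≡ true) (F-side : Side F e) (t : Apex F e a b)
           (γ : Path (Apex.c t)) (γ-simple : Simple γ)
           (γ⊆ : ∀ {e′} → e′ ∈ edges γ → Cl D γa γb e′) (e∉γ : e ∉ edges γ) where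
  open Disc disc
  open Apex t

  γ⊆′ : ∀ {e′} → e′ ∈ edges γ → Cl D γb γa e′
  γ⊆′ i with γ⊆ i
  ... | inj₁ (inj₁ k) = inj₁ (inj₂ k)
  ... | inj₁ (inj₂ k) = inj₁ (inj₁ k)
  ... | inj₂ s        = inj₂ s

  module Left  = Split disc F∈D F-side t γ γ-simple γ⊆ e∉γ
  module Right = Split (Disc-swap disc) F∈D F-side (Apex-swap t) γ γ-simple γ⊆′ e∉γ

  -- The boundaries of `D`, of the two pieces and of the triangle `F` add up to zero, and `flat`
  -- turns this into an identity of regions.
  sum : ∀ f → ((D f xor Left.D₁ f) xor Right.D₁ f) xor (F ≡ᶠ f) ≡ false
  sum = flat (λ f → ((D f xor Left.D₁ f) xor Right.D₁ f) xor (F ≡ᶠ f)) (ground , ground′) λ e′ → trans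
    (trans (∂-xor (λ f → (D f xor Left.D₁ f) xor Right.D₁ f) (F ≡ᶠ_) e′) (cong (_xor ∂ (F ≡ᶠ_) e′)
      (trans (∂-xor (λ f → D f xor Left.D₁ f) Right.D₁ e′) (cong (_xor ∂ Right.D₁ e′) (∂-xor D Left.D₁ e′)))))
    (trans (cong₂ _xor_ (cong₂ _xor_ (cong₂ _xor_ (bdry e′) (Left.∂D₁ e′)) (Right.∂D₁ e′)) (∂-apex e′))
    (solve 6 (λ a b c e e₁ e₂ → ((((a :+ b) :+ e) :+ ((a :+ c) :+ e₁)) :+ ((b :+ c) :+ e₂)) :+ ((e :+ e₁) :+ e₂)
                := con false) refl
       (chain γa e′) (chain γb e′) (chain γ e′) (e ≡ᵉ e′) (e₁ ≡ᵉ e′) (e₂ ≡ᵉ e′)))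
    where
    open xor-∧-Solver
    avoid : ∀ f → D f ≡ false → (F ≡ᶠ f) ≡ false
    avoid f eq = not-true λ eq′ → true≢false F∈D (trans (cong D (≡ᶠ-sound F f eq′)) eq)
    ground : ∀ y → ((D (Lo 0 y) xor false) xor false) xor (F ≡ᶠ Lo 0 y) ≡ false
    ground y rewrite avoid (Lo 0 y) (proj₁ grounded y) | proj₁ grounded y = refl
    ground′ : ∀ x → ((D (Up x 0) xor false) xor false) xor (F ≡ᶠ Up x 0) ≡ false
    ground′ x rewrite avoid (Up x 0) (proj₂ grounded x) | proj₂ grounded x = refl

  -- Off `γ` each piece is constant around `v`. If `v` were in neither, `sum` would make every face
  -- at `v` equal to `F`, but the two sides of the edge `h` differ.
  halves : ∀ {v} → Q D v → v ∉ verts γ → Q Left.D₁ v ⊎ Q Right.D₁ v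
  halves {v} q v∉ with fan Left.D₁ (fill-grounded Left.loop) v (closed-off Left.closed₁ (Thin⇒∉ D {γ = γa} grounded thin q) v∉)
                     | fan Right.D₁ (fill-grounded Right.loop) v (closed-off Right.closed₁ (Thin⇒∉ D {γ = γb} grounded thin′ q) v∉)
  ... | true  , l | _         = inj₁ (mkQ l)
  ... | false , _ | true  , r = inj₂ (mkQ r)
  ... | false , l | false , r = ⊥-elim (lo≢up (trans
    (sym (is-F (proj₁ (around q (here refl))) (proj₁ (l (here refl))) (proj₁ (r (here refl)))))
    (is-F (proj₂ (around q (here refl))) (proj₂ (l (here refl))) (proj₂ (r (here refl))))))
    where
    h = hE (proj₁ v) (proj₂ v)
    lo≢up : lo h ≢ up h
    lo≢up ()
    is-F : ∀ {f} → D f ≡ true → Left.D₁ f ≡ false → Right.D₁ f ≡ false → F ≡ f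
    is-F {f} x y z = ≡ᶠ-sound F f (on (trans (cong (_xor (F ≡ᶠ f)) (sym (cong₂ _xor_ (cong₂ _xor_ x y) z))) (sum f)))
      where
      on : ∀ {b} → true xor b ≡ false → b ≡ true
      on {true} _ = refl

-- Recovering a closing edge off the paths

record Reduced (D : Region) {a b} (γ : Path a) (γ′ : Path b) : Set where
  field
    {p q}   : Pt
    edge    : Edge
    δ       : Path p
    δ′      : Path q
    disc    : Disc D δ δ′ edge
    δ⊆γ     : verts δ ⊆ verts γ
    δ′⊆γ′   : verts δ′ ⊆ verts γ′
    edges⊆  : edges δ ⊆ edges γ
    edges′⊆ : edges δ′ ⊆ edges γ′

tail-between : ∀ {D a b c e} {j : Joins e a c} {γ : Path c} {γ′ : Path b} →
               Between D (step e j γ) γ′ → Between D γ γ′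
tail-between {D} {e = e} {j} {γ} {γ′} d = record
  { grounded = grounded ; thin = thin ∘ there ; thin′ = thin′ ; simple = proj₂ simple ; simple′ = simple′
  ; maximal = λ φ g c → maximal φ g λ {e′} eq → cl (c {e′} eq) }
  where
  open Between d
  cl : ∀ {e′} → Cl D γ γ′ e′ → Cl D (step e j γ) γ′ e′
  cl (inj₁ (inj₁ i)) = inj₁ (inj₁ (there i))
  cl (inj₁ (inj₂ i)) = inj₁ (inj₂ i)
  cl (inj₂ s)        = inj₂ s

first-edge : ∀ {a c e e′ w} {j : Joins e a c} {γ : Path c} → Simple (step e j γ) →
             Joins e′ a w → e′ ∈ edges (step e j γ) → e′ ≡ e
first-edge s k (here eq) = eq
first-edge {γ = γ} (p∉ , _) k (there i) = ⊥-elim (p∉ (ends∈verts γ i k))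

move-last : ∀ e c c′ → (e xor c) xor c′ ≡ (c xor c′) xor e
move-last = solve 3 (λ e c c′ → (e :+ c) :+ c′ := (c :+ c′) :+ e) refl
  where open xor-∧-Solver

cancel-both : ∀ e c c′ → (e xor c) xor (e xor c′) ≡ c xor c′
cancel-both = solve 3 (λ e c c′ → (e :+ c) :+ (e :+ c′) := c :+ c′) refl
  where open xor-∧-Solver

cancelˡ : ∀ e c c′ → ((e xor c) xor c′) xor e ≡ c xor c′
cancelˡ = solve 3 (λ e c c′ → ((e :+ c) :+ c′) :+ e := c :+ c′) refl
  where open xor-∧-Solver

Reduced-mono : ∀ {D a b c d} {γ : Path a} {γ′ : Path b} {η : Path c} {η′ : Path d} →
               verts γ ⊆ verts η → verts γ′ ⊆ verts η′ → edges γ ⊆ edges η → edges γ′ ⊆ edges η′ →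
               Reduced D γ γ′ → Reduced D η η′
Reduced-mono v v′ x x′ r = record
  { edge = edge ; δ = δ ; δ′ = δ′ ; disc = disc
  ; δ⊆γ = v ∘ δ⊆γ ; δ′⊆γ′ = v′ ∘ δ′⊆γ′ ; edges⊆ = x ∘ edges⊆ ; edges′⊆ = x′ ∘ edges′⊆ }
  where open Reduced r

-- Common first edges cancel and are stripped from both paths. Where the paths part, the first edge
-- of `γ` becomes the closing edge; if they never part, the boundary is zero.
reduce-lens : ∀ {D p} (γ γ′ : Path p) → Between D γ γ′ → (∀ e → ∂ D e ≡ chain γ e xor chain γ′ e) →
              Reduced D γ γ′ ⊎ (∀ f → D f ≡ false)
reduce-lens {D} end end d bdry = inj₂ (flat D (Between.grounded d) bdry)
reduce-lens end (step e j γ′) d bdry = ⊥-elim (proj₁ (Between.simple′ d) (origin∈verts γ′))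
reduce-lens (step e j γ) end d bdry = ⊥-elim (proj₁ (Between.simple d) (origin∈verts γ))
reduce-lens {D} {p} (step {q = q} e j γ) (step {q = q′} e′ j′ γ′) d bdry = compare (e ≟ᵉ e′)
  where
  same : e ≡ e′ → q ≡ q′ → Reduced D (step e j γ) (step e′ j′ γ′) ⊎ (∀ f → D f ≡ false)
  same refl refl = map₁ (Reduced-mono there there there there)
    (reduce-lens γ γ′ (Between-swap (tail-between (Between-swap (tail-between d))))
      (λ f → trans (bdry f) (cancel-both (e ≡ᵉ f) (chain γ f) (chain γ′ f))))
  compare : Dec (e ≡ e′) → Reduced D (step e j γ) (step e′ j′ γ′) ⊎ (∀ f → D f ≡ false)
  compare (yes refl) = same refl (Joins-functional j j′)
  compare (no ne) = inj₁ record
    { edge = e ; δ = γ ; δ′ = step e′ j′ γ′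
    ; disc = record
      { closed = record
        { between = tail-between d ; joins = Joins-sym j
        ; bdry = λ f → trans (bdry f) (move-last (e ≡ᵉ f) (chain γ f) (chain (step e′ j′ γ′) f)) }
      ; fresh = λ i → proj₁ (Between.simple d) (ends∈verts γ i j)
      ; fresh′ = λ i → ne (first-edge {j = j′} {γ′} (Between.simple′ d) j i) }
    ; δ⊆γ = there ; δ′⊆γ′ = id ; edges⊆ = there ; edges′⊆ = id }

-- As the path is simple and `e` ends at its tip, `e` is its first edge. It cancels, which leaves
-- two paths from the same point.
reduceˡ : ∀ {D a b e} (γ : Path a) (γ′ : Path b) → Closed D γ γ′ e → e ∈ edges γ → Reduced D γ γ′ ⊎ (∀ f → D f ≡ false)
reduceˡ {D} {b = b} {e} (step {q = q} e₀ j γ) γ′ d i =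
  peel (first-edge {j = j} {γ} (Closed.simple d) (Closed.joins d) i)
  where
  peel′ : e ≡ e₀ → b ≡ q → Reduced D (step e₀ j γ) γ′ ⊎ (∀ f → D f ≡ false)
  peel′ refl refl = map₁ (Reduced-mono there id there id)
    (reduce-lens γ γ′ (tail-between (Closed.between d))
      (λ f → trans (Closed.bdry d f) (cancelˡ (e ≡ᵉ f) (chain γ f) (chain γ′ f))))
  peel : e ≡ e₀ → Reduced D (step e₀ j γ) γ′ ⊎ (∀ f → D f ≡ false)
  peel refl = peel′ refl (Joins-functional (Closed.joins d) j)

Reduced-swap : ∀ {D a b} {γ : Path a} {γ′ : Path b} → Reduced D γ γ′ → Reduced D γ′ γ
Reduced-swap r = record
  { edge = edge ; δ = δ′ ; δ′ = δ ; disc = Disc-swap disc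
  ; δ⊆γ = δ′⊆γ′ ; δ′⊆γ′ = δ⊆γ ; edges⊆ = edges′⊆ ; edges′⊆ = edges⊆ }
  where open Reduced r

reduce : ∀ {D a b e} {γ : Path a} {γ′ : Path b} → Closed D γ γ′ e → Reduced D γ γ′ ⊎ (∀ f → D f ≡ false)
reduce {e = e} {γ} {γ′} d with e ∈ᵉ? edges γ | e ∈ᵉ? edges γ′
... | yes i | _     = reduceˡ γ γ′ d i
... | no _  | yes i = map₁ Reduced-swap (reduceˡ γ′ γ (Closed-swap d) i)
... | no i  | no k  = inj₁ record
  { edge = e ; δ = γ ; δ′ = γ′ ; disc = record { closed = d ; fresh = i ; fresh′ = k }
  ; δ⊆γ = id ; δ′⊆γ′ = id ; edges⊆ = id ; edges′⊆ = id }

-- Levels, geodesics and guards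

-- Warshall's algorithm: reachability through the listed states is decidable.
module Warshall {A : Set} (_≟_ : DecidableEquality A) {St : A → A → Set} (St? : ∀ x y → Dec (St x y)) where

  Via : List A → A → A → Set
  Via []       x y = x ≡ y ⊎ St x y
  Via (z ∷ zs) x y = Via zs x y ⊎ (Via zs x z × Via zs z y)

  via? : ∀ zs x y → Dec (Via zs x y)
  via? []       x y = (x ≟ y) ⊎-dec St? x y
  via? (z ∷ zs) x y = via? zs x y ⊎-dec (via? zs x z ×-dec via? zs z y)

  via-base : ∀ zs {x y} → x ≡ y ⊎ St x y → Via zs x y
  via-base []       b = b
  via-base (z ∷ zs) b = inj₁ (via-base zs b)

  via-trans : ∀ {zs x z y} → z ∈ zs → Via zs x z → Via zs z y → Via zs x y
  via-trans (here refl) u v = inj₂ ([ id , proj₁ ]′ u , [ id , proj₂ ]′ v)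
  via-trans (there i) (inj₁ u)        (inj₁ v)        = inj₁ (via-trans i u v)
  via-trans (there i) (inj₁ u)        (inj₂ (v , v′)) = inj₂ (via-trans i u v , v′)
  via-trans (there i) (inj₂ (u , u′)) (inj₁ v)        = inj₂ (u , via-trans i u′ v)
  via-trans (there i) (inj₂ (u , _))  (inj₂ (_ , v))  = inj₂ (u , v)

  via-snoc : ∀ {zs x z y} → z ∈ zs → Via zs x z → St z y → Via zs x y
  via-snoc {zs} i u s = via-trans i u (via-base zs (inj₂ s))

  via-preserves : ∀ {P : A → Set} → (∀ {x y} → St x y → P x → P y) → ∀ zs {x y} → Via zs x y → P x → P y
  via-preserves pres []       (inj₁ refl)    p = p
  via-preserves pres []       (inj₂ s)       p = pres s p
  via-preserves pres (z ∷ zs) (inj₁ u)       p = via-preserves pres zs u p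
  via-preserves pres (z ∷ zs) (inj₂ (u , v)) p = via-preserves pres zs v (via-preserves pres zs u p)

least : ∀ {P : ℕ → Set} → (∀ k → Dec (P k)) → ∀ k → P k → ∃ λ m → P m × (∀ {j} → j < m → ¬ P j)
least P? zero p = 0 , p , λ ()
least P? (suc k) p with P? 0
... | yes p₀ = 0 , p₀ , λ ()
... | no ¬p₀ with least (P? ∘ suc) k p
...   | m , q , min = suc m , q , λ { {zero} _ → ¬p₀ ; {suc j} (s≤s j<m) → min j<m }

fin-bound : ∀ {k} (f : Fin k → ℕ) → ∃ λ B → ∀ i → f i ≤ B
fin-bound {zero}  f = 0 , λ ()
fin-bound {suc k} f with fin-bound (f ∘ suc)
... | B , b = f zero ⊔ B , λ { zero → m≤m⊔n (f zero) B ; (suc i) → ≤-trans (b i) (m≤n⊔m (f zero) B) }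

joins? : ∀ e p q → Dec (Joins e p q)
joins? e p q = ((src e ≟ᵖ p) ×-dec (tgt e ≟ᵖ q)) ⊎-dec ((src e ≟ᵖ q) ×-dec (tgt e ≟ᵖ p))

Q? : ∀ D p → Dec (Q D p)
Q? D p = map′ (λ a → mkQ (All.lookup a)) (λ q → All.tabulate (around q))
  (all? (λ e → (D (lo e) Bool.≟ true) ×-dec (D (up e) Bool.≟ true)) (inc p))

Q-mono : ∀ {D D′} → (∀ {f} → D′ f ≡ true → D f ≡ true) → ∀ {p} → Q D′ p → Q D p
Q-mono D′⊆D q = mkQ λ i → D′⊆D (proj₁ (around q i)) , D′⊆D (proj₂ (around q i))

data Walk (P : Pt → Set) : Pt → Pt → Set where
  stop : ∀ {p} → P p → Walk P p p
  step : ∀ {e p q r} → P p → Joins e p q → Walk P q r → Walk P p r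

Walk-start : ∀ {P p q} → Walk P p q → P p
Walk-start (stop x)     = x
Walk-start (step x _ _) = x

-- The geometry that the chase needs: `G` is the intersection graph of connected sets of grid points
-- which leave no point of `box` uncovered.
record Drawing (G : Graph) : Set₁ where
  field
    S           : Fin (n G) → Pt → Set
    S?          : ∀ v p → Dec (S v p)
    connected   : ∀ {v p q} → S v p → S v q → Walk (S v) p q
    inhabited   : ∀ v → ∃ (S v)
    share⇒adj   : ∀ {u v p} → u ≢ v → S u p → S v p → Adj G u v
    adj⇒share   : ∀ {u v} → Adj G u v → ∃ λ p → S u p × S v p
    root        : Fin (n G)
    root∋origin : S root origin
    reach-root  : ∀ v → Reach G v root
    box         : List Pt
    S⊆box       : ∀ {v p} → S v p → p ∈ box
    covered     : ∀ {p} → p ∈ box → ∃ λ v → S v p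
    whole       : Region
    Q⊆box       : ∀ {p} → Q whole p → p ∈ box
    faces       : List Face
    whole⊆faces : ∀ {f} → whole f ≡ true → f ∈ faces

module Territory {G : Graph} (drawing : Drawing G) where
  open Drawing drawing public

  V : Set
  V = Fin (n G)

  Share : V → V → Set
  Share u v = ∃ λ p → S u p × S v p

  record In (D : Region) (r : V) : Set where
    constructor mkIn
    field within : ∀ {p} → S r p → Q D p
  open In public

  In-mono : ∀ {D D′} → (∀ {f} → D′ f ≡ true → D f ≡ true) → ∀ {r} → In D′ r → In D r
  In-mono D′⊆D i = mkIn λ s → Q-mono D′⊆D (within i s)

  in? : ∀ D r → Dec (In D r)
  in? D r = map′ (λ a → mkIn λ s → All.lookup a (S⊆box s) s) (λ i → All.tabulate λ _ → within i)
    (all? (λ p → S? r p →-dec Q? D p) box)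

  Strung : ∀ {p} → Path p → Set
  Strung γ = ∀ {e} → e ∈ edges γ → ∃ λ v → S v (src e) × S v (tgt e)

  -- The last point need not be interior: it may be the point at which the set first meets a curve.
  data Flow (D : Region) (v : V) : Pt → Pt → Set where
    stop : ∀ {p} → S v p → Flow D v p p
    step : ∀ {e p q r} → Q D p → S v p → Joins e p q → Flow D v q r → Flow D v p r

  Flow-start : ∀ {D v p q} → Flow D v p q → S v p
  Flow-start (stop s)       = s
  Flow-start (step _ s _ _) = s

  Flow-end : ∀ {D v p q} → Flow D v p q → S v q
  Flow-end (stop s)       = s
  Flow-end (step _ _ _ w) = Flow-end w

  Flow-mono : ∀ {D D′} → (∀ {f} → D′ f ≡ true → D f ≡ true) → ∀ {v p q} → Flow D′ v p q → Flow D v p q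
  Flow-mono i (stop s)       = stop s
  Flow-mono i (step q s j w) = step (Q-mono i q) s j (Flow-mono i w)

  -- The two inequalities in `catch` are level - 2 ≤ i ≤ level + 1 without subtraction, one value
  -- for each of the four cops. The set `r′` to be caught is not assumed to lie in `D`.
  record Guard (D : Region) (Z : List Pt) : Set where
    field
      post       : ℕ → V
      post-root  : post 0 ≡ root
      post-share : ∀ i → Share (post i) (post (suc i))
      level      : V → ℕ
      level-lip  : ∀ {r r′} → In D r → In D r′ → Share r r′ → level r′ ≤ suc (level r)
      catch      : ∀ {r r′ h z} → In D r → S r h → Flow D r′ h z → z ∈ Z →
                   ∃ λ i → Share (post i) r′ × level r ≤ suc (suc i) × i ≤ suc (level r)

  -- All conditions are about robbers and flows inside the region, so levels computed in a larger
  -- region can be kept after a cut.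
  Guard-mono : ∀ {D D′ Z Z′} → (∀ {f} → D′ f ≡ true → D f ≡ true) → (∀ {z} → z ∈ Z′ → z ∈ Z) → Guard D Z → Guard D′ Z′
  Guard-mono {D} {D′} D′⊆D Z′⊆Z g = record
    { post = post ; post-root = post-root ; post-share = post-share ; level = level
    ; level-lip = λ a b → level-lip (In-mono D′⊆D a) (In-mono D′⊆D b)
    ; catch = λ a h w z → catch (In-mono D′⊆D a) h (Flow-mono D′⊆D w) (Z′⊆Z z) }
    where open Guard g

  module Levels {D a b e} {γa : Path a} {γb : Path b} (disc : Disc D γa γb e)
                (D⊆whole : ∀ {f} → D f ≡ true → whole f ≡ true)
                (strungₐ : Strung γa) (strung-b : Strung γb) where
    open Disc disc

    -- Less than `Cl`: an edge off the paths needs an interior end, not just a face of `D` beside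
    -- it. This keeps out the closing edge, as `Split` demands of the new curve.
    Arena : Edge → Set
    Arena e = (e ∈ edges γa ⊎ e ∈ edges γb) ⊎ (Q D (src e) ⊎ Q D (tgt e))

    arena? : ∀ e → Dec (Arena e)
    arena? e = ((e ∈ᵉ? edges γa) ⊎-dec (e ∈ᵉ? edges γb)) ⊎-dec (Q? D (src e) ⊎-dec Q? D (tgt e))

    Arena-Q : ∀ {e p q} → Joins e p q → Q D p → Arena e
    Arena-Q (inj₁ (refl , refl)) x = inj₂ (inj₁ x)
    Arena-Q (inj₂ (refl , refl)) x = inj₂ (inj₂ x)

    Arena⇒Cl : ∀ {e} → Arena e → Cl D γa γb e
    Arena⇒Cl (inj₁ i) = inj₁ i
    Arena⇒Cl {e} (inj₂ (inj₁ q)) = inj₂ (inj₁ (proj₁ (around q (src∈inc e))))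
    Arena⇒Cl {e} (inj₂ (inj₂ q)) = inj₂ (inj₁ (proj₁ (around q (tgt∈inc e))))

    tip∉Arena : ¬ Arena e
    tip∉Arena (inj₁ (inj₁ i)) = fresh i
    tip∉Arena (inj₁ (inj₂ i)) = fresh′ i
    tip∉Arena (inj₂ q) = bad joins q
      where
      a∉ : ¬ Q D a
      a∉ q = Thin⇒∉ D {γ = γa} grounded thin q (tip∈verts γa)
      b∉ : ¬ Q D b
      b∉ q = Thin⇒∉ D {γ = γb} grounded thin′ q (tip∈verts γb)
      bad : Joins e a b → Q D (src e) ⊎ Q D (tgt e) → ⊥
      bad (inj₁ (refl , refl)) (inj₁ q) = a∉ q
      bad (inj₁ (refl , refl)) (inj₂ q) = b∉ q
      bad (inj₂ (refl , refl)) (inj₁ q) = b∉ q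
      bad (inj₂ (refl , refl)) (inj₂ q) = a∉ q

    -- v is reached at p by a curve inside the arena that starts at the origin in the root
    -- and changes k times from one set to another.
    data R : ℕ → V → Pt → Set where
      start  : R 0 root origin
      walk   : ∀ {k v p q e} → R k v p → Joins e p q → Arena e → S v q → R k v q
      switch : ∀ {k u v p} → R k u p → S v p → R (suc k) v p

    R⇒S : ∀ {k v p} → R k v p → S v p
    R⇒S start          = root∋origin
    R⇒S (walk _ _ _ s) = s
    R⇒S (switch _ s)   = s

    State : Set
    State = ℕ × V × Pt

    data Step : State → State → Set where
      walk   : ∀ {k v p q} → Any (λ e → Joins e p q × Arena e) (inc p) → S v q → Step (k , v , p) (k , v , q)
      switch : ∀ {k u v p} → S v p → Step (k , u , p) (suc k , v , p)

    step? : ∀ x y → Dec (Step x y)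
    step? (k , v , p) (k′ , v′ , p′) = map′ to from
      (((k ≟ k′) ×-dec (v Fin.≟ v′) ×-dec any? (λ e → joins? e p p′ ×-dec arena? e) (inc p) ×-dec S? v p′)
       ⊎-dec ((suc k ≟ k′) ×-dec (p ≟ᵖ p′) ×-dec S? v′ p))
      where
      Cond : Set
      Cond = (k ≡ k′ × v ≡ v′ × Any (λ e → Joins e p p′ × Arena e) (inc p) × S v p′)
             ⊎ (suc k ≡ k′ × p ≡ p′ × S v′ p)
      to : Cond → Step (k , v , p) (k′ , v′ , p′)
      to (inj₁ (refl , refl , j , s)) = walk j s
      to (inj₂ (refl , refl , s))     = switch s
      from : Step (k , v , p) (k′ , v′ , p′) → Cond
      from (walk j s) = inj₁ (refl , refl , j , s)
      from (switch s) = inj₂ (refl , refl , s)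

    state-≟ : DecidableEquality State
    state-≟ = ≡-dec _≟_ (≡-dec Fin._≟_ _≟ᵖ_)

    open Warshall state-≟ step?

    states : ℕ → List State
    states k = cartesianProduct (upTo (suc k)) (cartesianProduct (allFin (n G)) box)

    ∈-states : ∀ {k m v p} → m ≤ k → S v p → (m , v , p) ∈ states k
    ∈-states m≤k s = ∈-cartesianProduct⁺ (∈-upTo⁺ (s≤s m≤k)) (∈-cartesianProduct⁺ (∈-allFin _) (S⊆box s))

    R⇒Via : ∀ {m v p} k → m ≤ k → R m v p → Via (states k) (0 , root , origin) (m , v , p)
    R⇒Via k m≤k start = via-base (states k) (inj₁ refl)
    R⇒Via k m≤k (walk r j a s) = via-snoc (∈-states m≤k (R⇒S r)) (R⇒Via k m≤k r) (walk (lose (Joins⇒inc j) (j , a)) s)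
    R⇒Via k m<k (switch r s) = via-snoc (∈-states (<⇒≤ m<k) (R⇒S r)) (R⇒Via k (<⇒≤ m<k) r) (switch s)

    Reached : State → Set
    Reached (k , v , p) = R k v p

    Step-R : ∀ {x y} → Step x y → Reached x → Reached y
    Step-R (walk j s) r with find j
    ... | e , _ , k , a = walk r k a s
    Step-R (switch s) r = switch r s

    -- The number of switches never decreases along a curve, so the finitely many states with at
    -- most `k` switches suffice.
    R? : ∀ k v p → Dec (R k v p)
    R? k v p = map′ (λ u → via-preserves {P = Reached} Step-R (states k) u start) (R⇒Via k ≤-refl)
      (via? (states k) (0 , root , origin) (k , v , p))

    Level : ℕ → Pt → Set
    Level k p = (∃ λ v → R k v p) × (∀ {m} → m < k → ¬ ∃ λ v → R m v p)

    Level-unique : ∀ {k m p} → Level k p → Level m p → k ≡ m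
    Level-unique (r , min) (r′ , min′) = ≤-antisym (≮⇒≥ λ m<k → min m<k r′) (≮⇒≥ λ k<m → min′ k<m r)

    Outlet : Pt → Set
    Outlet p = p ∈ verts γa ⊎ p ∈ verts γb

    exit : ∀ {e p q} → Joins e p q → Q D p → ¬ Q D q → Outlet q
    exit {q = q} j x ¬q with q ∈ᵖ? verts γa | q ∈ᵖ? verts γb
    ... | yes i | _     = inj₁ i
    ... | no _  | yes i = inj₂ i
    ... | no i  | no k  = ⊥-elim (¬q (Q-spread closed j x i k))

    -- A switch before every edge is wasteful, but only the existence of some number of switches is
    -- wanted here.
    R-curve : ∀ {c z} (γ : Path c) → Strung γ → (∀ {e} → e ∈ edges γ → Arena e) → z ∈ verts γ → ∃₂ λ k v → R k v z
    R-curve end str ar (here refl) = 0 , root , start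
    R-curve (step e j γ) str ar (there i) = R-curve γ (str ∘ there) (ar ∘ there) i
    R-curve (step {p} {q} e j γ) str ar (here refl)
      with R-curve γ (str ∘ there) (ar ∘ there) (tip∈verts γ) | str (here refl)
    ... | k , u , r | v , s , s′ = suc k , v , walk (switch r (at-q j)) (Joins-sym j) (ar (here refl)) (at-p j)
      where
      at-q : Joins e p q → S v q
      at-q (inj₁ (refl , refl)) = s′
      at-q (inj₂ (refl , refl)) = s
      at-p : Joins e p q → S v p
      at-p (inj₁ (refl , refl)) = s
      at-p (inj₂ (refl , refl)) = s′

    R-outlet : ∀ {z} → Outlet z → ∃₂ λ k v → R k v z
    R-outlet (inj₁ i) = R-curve γa strungₐ (inj₁ ∘ inj₁) i
    R-outlet (inj₂ i) = R-curve γb strung-b (inj₁ ∘ inj₂) i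

    R-flow : ∀ {k v p q} → Flow D v p q → R k v p → R k v q
    R-flow (stop _)       r = r
    R-flow (step x s j w) r = R-flow w (walk r j (Arena-Q j x) (Flow-start w))

    R-flow⁻ : ∀ {k v p q} → Flow D v p q → R k v q → R k v p
    R-flow⁻ (stop _)       r = r
    R-flow⁻ (step x s j w) r = walk (R-flow⁻ w r) (Joins-sym j) (Arena-Q j x) s

    leave : ∀ {v p q} → Walk (S v) p q → Q D p → (∃ λ z → Outlet z × Flow D v p z) ⊎ (Q D q × Flow D v p q)
    leave (stop s) x = inj₂ (x , stop s)
    leave (step {q = p′} s j w) x with Q? D p′
    ... | no ¬x  = inj₁ (p′ , exit j x ¬x , step x s j (stop (Walk-start w)))
    ... | yes x′ with leave w x′
    ...   | inj₁ (z , o , fl) = inj₁ (z , o , step x s j fl)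
    ...   | inj₂ (y , fl)     = inj₂ (y , step x s j fl)

    -- Follow a chain of sets towards the root. The first time it leaves the interior it hits a
    -- bounding path, whose points are reached, and the flow up to there can be reversed. It must
    -- leave, since the root contains the origin.
    R-reach : ∀ {v p} → Reach G v root → S v p → Q D p → ∃ λ k → R k v p
    R-reach here s x with leave (connected s root∋origin) x
    ... | inj₂ (o , _) = ⊥-elim (origin∉Q D grounded o)
    ... | inj₁ (z , o , fl) with R-outlet o
    ...   | k , u , r = suc k , R-flow⁻ fl (switch r (Flow-end fl))
    R-reach (step a ρ) s x with adj⇒share a
    ... | h , s′ , t with leave (connected s s′) x
    ...   | inj₁ (z , o , fl) with R-outlet o
    ...     | k , u , r = suc k , R-flow⁻ fl (switch r (Flow-end fl))
    R-reach (step a ρ) s x | h , s′ , t | inj₂ (y , fl) with R-reach ρ t y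
    ...     | k , r = suc k , R-flow⁻ fl (switch r s′)

    R-Q : ∀ {p} → Q D p → ∃₂ λ k v → R k v p
    R-Q {p} x with covered (Q⊆box (Q-mono D⊆whole x))
    ... | v , s with R-reach (reach-root v) s x
    ...   | k , r = k , v , r

    level-exists : ∀ {p} → (∃₂ λ k v → R k v p) → ∃ λ k → Level k p
    level-exists {p} (k , r) with least (λ m → Fin.any? λ v → R? m v p) k r
    ... | m , r′ , min = m , r′ , min

    -- A curve with one set per level. The edge of a `down` step lies in the upper set, so the two
    -- sets share its lower end `q`.
    data Tight : ∀ {p} → ℕ → V → Path p → Set where
      end  : Tight 0 root end
      same : ∀ {k v p q e} {j : Joins e p q} {γ : Path q} → Level k p → S v p → Arena e →
             Tight k v γ → Tight k v (step e j γ)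
      down : ∀ {k u v p q e} {j : Joins e p q} {γ : Path q} → Level (suc k) p → S v p → S v q → Arena e →
             Tight k u γ → Tight (suc k) v (step e j γ)

    Tight-tip : ∀ {p k v} {γ : Path p} → Tight k v γ → Level k p × S v p
    Tight-tip end              = ((root , start) , λ ()) , root∋origin
    Tight-tip (same l s _ _)   = l , s
    Tight-tip (down l s _ _ _) = l , s

    -- The last component lets `extend` shorten a path that returns to its new tip without changing
    -- the set at the tip.
    suffix : ∀ {p k v z} {γ : Path p} → Tight k v γ → Simple γ → z ∈ verts γ →
             ∃ λ m → ∃ λ w → ∃ λ (δ : Path z) → Tight m w δ × Simple δ × m ≤ k × (m ≡ k → w ≡ v)
    suffix t@end                si (here refl) = _ , _ , _ , t , si , ≤-refl , λ _ → refl
    suffix t@(same _ _ _ _)     si (here refl) = _ , _ , _ , t , si , ≤-refl , λ _ → refl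
    suffix t@(down _ _ _ _ _)   si (here refl) = _ , _ , _ , t , si , ≤-refl , λ _ → refl
    suffix (same _ _ _ t)       si (there i) = suffix t (proj₂ si) i
    suffix (down _ _ _ _ t)     si (there i) with suffix t (proj₂ si) i
    ... | m , w , δ , t′ , si′ , m≤k , _ =
      m , w , δ , t′ , si′ , m≤n⇒m≤1+n m≤k , λ { refl → ⊥-elim (<-irrefl refl m≤k) }

    Geodesic : ℕ → Set
    Geodesic k = ∀ {p} → Level k p → ∃ λ v → ∃ λ (γ : Path p) → Tight k v γ × Simple γ

    -- Induction on the derivation of `R k v p`. While the previous point has level `k` the path
    -- continues in `v`; once it has a lower level, an arbitrary geodesic of that level takes over.
    extend : ∀ {k} → (∀ {m} → suc m ≡ k → Geodesic m) → ∀ {v p} → R k v p → Level k p →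
             ∃ λ (γ : Path p) → Tight k v γ × Simple γ
    extend below start l = end , end , _
    extend below (switch r s) l = ⊥-elim (proj₂ l ≤-refl (_ , r))
    extend {k} below {v} {p} (walk {p = p₁} {e = e} r j a s) l
      with anyUpTo? (λ m → Fin.any? λ u → R? m u p₁) k
    ... | no none with extend below r ((v , r) , λ m<k r′ → none (_ , m<k , r′))
    ...   | γ , t , si with p ∈ᵖ? verts γ
    ...     | no p∉ = step e (Joins-sym j) γ , same l s a t , p∉ , si
    ...     | yes i with suffix t si i
    ...       | m , w , δ , t′ , si′ , _ , same-set
                with refl ← Level-unique (proj₁ (Tight-tip t′)) l
                with refl ← same-set refl = δ , t′ , si′
    extend {k} below {v} {p} (walk {p = p₁} {e = e} r j a s) l
      | yes (m , m<k , u , r′) with ≤∧≮⇒≡ m<k (not-lower r′)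
      where
      -- One switch to `v` at `p₁` would otherwise reach `p` below its level.
      not-lower : ∀ {m u} → R m u p₁ → ¬ (suc m < k)
      not-lower r′ lt = proj₂ l lt (v , walk (switch r′ (R⇒S r)) j a s)
    ...   | refl with below refl {p₁} ((u , r′) , λ i<m (w , r″) →
                    proj₂ l (s≤s i<m) (v , walk (switch r″ (R⇒S r)) j a s))
    ...     | u′ , γ , t , si = step e (Joins-sym j) γ , down l s (R⇒S r) a t , p∉ , si
      where
      p∉ : p ∉ verts γ
      p∉ i with suffix t si i
      ... | i , w , δ , t′ , _ , i≤m , _ = proj₂ l (s≤s i≤m) (proj₁ (proj₁ (Tight-tip t′)))

    geodesic : ∀ k → Geodesic k
    geodesic zero    ((v , r) , min) = v , extend (λ ()) r ((v , r) , min)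
    geodesic (suc k) ((v , r) , min) = v , extend (λ { refl → geodesic k }) r ((v , r) , min)

    Tight-Arena : ∀ {p k v e′} {γ : Path p} → Tight k v γ → e′ ∈ edges γ → Arena e′
    Tight-Arena (same _ _ a _)   (here refl) = a
    Tight-Arena (down _ _ _ a _) (here refl) = a
    Tight-Arena (same _ _ _ t)   (there i)   = Tight-Arena t i
    Tight-Arena (down _ _ _ _ t) (there i)   = Tight-Arena t i

    S-ends : ∀ {e p q v} → Joins e p q → S v p → S v q → S v (src e) × S v (tgt e)
    S-ends (inj₁ (refl , refl)) s s′ = s , s′
    S-ends (inj₂ (refl , refl)) s s′ = s′ , s

    Tight-Strung : ∀ {p k v} {γ : Path p} → Tight k v γ → Strung γ
    Tight-Strung (same {j = j} _ s _ t) (here refl) = _ , S-ends j s (proj₂ (Tight-tip t))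
    Tight-Strung (down {j = j} _ s s′ _ t) (here refl) = _ , S-ends j s s′
    Tight-Strung (same _ _ _ t)   (there i) = Tight-Strung t i
    Tight-Strung (down _ _ _ _ t) (there i) = Tight-Strung t i

    label : ∀ {p k v} {γ : Path p} → Tight k v γ → ℕ → V
    label end                          i = root
    label (same _ _ _ t)               i = label t i
    label (down {k} {v = v} _ _ _ _ t) i with i ≤? k
    ... | yes _ = label t i
    ... | no _  = v

    label-top : ∀ {p k v} {γ : Path p} (t : Tight k v γ) {i} → k ≤ i → label t i ≡ v
    label-top end              k≤i = refl
    label-top (same _ _ _ t)   k≤i = label-top t k≤i
    label-top (down {k} _ _ _ _ t) {i} k<i with i ≤? k
    ... | yes i≤k = ⊥-elim (<-irrefl refl (≤-trans k<i i≤k))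
    ... | no _    = refl

    label-root : ∀ {p k v} {γ : Path p} (t : Tight k v γ) → label t 0 ≡ root
    label-root end              = refl
    label-root (same _ _ _ t)   = label-root t
    label-root (down {k} _ _ _ _ t) = label-root t

    label-share : ∀ {p k v} {γ : Path p} (t : Tight k v γ) i → Share (label t i) (label t (suc i))
    label-share end              i = origin , root∋origin , root∋origin
    label-share (same _ _ _ t)   i = label-share t i
    label-share (down {k} {q = q} _ _ s′ _ t) i with i ≤? k | suc i ≤? k
    ... | yes _   | yes _   = label-share t i
    ... | yes i≤k | no i≮k
      rewrite label-top t {i} (≮⇒≥ i≮k) = q , proj₂ (Tight-tip t) , s′
    ... | no i≰k  | yes i<k = ⊥-elim (i≰k (<⇒≤ i<k))
    ... | no _    | no _    = q , s′ , s′

    label-vert : ∀ {p k v z} {γ : Path p} (t : Tight k v γ) → z ∈ verts γ → ∃ λ i → Level i z × i ≤ k × S (label t i) z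
    label-vert end (here refl) = 0 , proj₁ (Tight-tip end) , z≤n , root∋origin
    label-vert {k = k} t@(same l s _ t′) (here refl) = k , l , ≤-refl , subst (λ v → S v _) (sym (label-top t′ ≤-refl)) s
    label-vert {k = k} t@(down l s _ _ _) (here refl) = k , l , ≤-refl , subst (λ v → S v _) (sym (label-top t ≤-refl)) s
    label-vert (same _ _ _ t) (there i) = label-vert t i
    label-vert {z = z} (down {k} {j = j} l s s′ a t) (there i) with label-vert t i
    ... | m , lev , m≤k , sz = m , lev , m≤n⇒m≤1+n m≤k , at
      where
      at : S (label (down {j = j} l s s′ a t) m) z
      at with m ≤? k
      ... | yes _  = sz
      ... | no m≰k = ⊥-elim (m≰k m≤k)

    flow-in : ∀ {v p q} → In D v → Walk (S v) p q → Flow D v p q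
    flow-in i (stop s)     = stop s
    flow-in i (step s j w) = step (within i s) s j (flow-in i w)

    -- The set of a robber inside `D` is joined by flows in both directions, so the number of
    -- switches does not depend on the point `h`. Outside `D` the value 0 is a dummy.
    robber-level : ∀ r → ∃ λ k → In D r → ∀ {h} → S r h → R k r h × (∀ {m} → m < k → ¬ R m r h)
    robber-level r with in? D r | inhabited r
    ... | no ¬i | _ = 0 , λ i → ⊥-elim (¬i i)
    ... | yes i | p , s with R-reach (reach-root r) s (within i s)
    ...   | k , ρ with least (λ m → R? m r p) k ρ
    ...     | m , ρ′ , min = m , λ _ s′ → let fl = flow-in i (connected s s′) in
                R-flow fl ρ′ , λ lt ρ″ → min lt (R-flow⁻ fl ρ″)

    guard : ∀ {c k v} {γ : Path c} → Tight k v γ → Guard D (verts γ)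
    guard t = record
      { post = label t ; post-root = label-root t ; post-share = label-share t
      ; level = λ r → proj₁ (robber-level r)
      ; level-lip = λ {r} {r′} i i′ (h , s , s′) →
          ≮⇒≥ λ lt → proj₂ (proj₂ (robber-level r′) i′ s′) lt (switch (proj₁ (proj₂ (robber-level r) i s)) s′)
      ; catch = λ {r} {r′} i s fl z∈ → caught i s fl z∈ }
      where
      -- Upper bound on the level of `r`: come along the curve to `z`, switch to `r′`, flow back to
      -- `h`, switch to `r`. Upper bound on the level of `z`: from `r` at `h` switch once to `r′`
      -- and flow to `z`.
      caught : ∀ {r r′ h z} → In D r → S r h → Flow D r′ h z → z ∈ verts _ →
               ∃ λ i → Share (label t i) r′ × proj₁ (robber-level r) ≤ suc (suc i) × i ≤ suc (proj₁ (robber-level r))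
      caught {r} i s fl z∈ with label-vert t z∈
      ... | m , ((u , ρ) , min) , _ , sz = m , (_ , sz , Flow-end fl)
            , ≮⇒≥ (λ lt → proj₂ (proj₂ (robber-level r) i s) lt (switch (R-flow⁻ fl (switch ρ (Flow-end fl))) s))
            , ≮⇒≥ (λ lt → min lt (_ , R-flow fl (switch (proj₁ (proj₂ (robber-level r) i s)) (Flow-start fl))))

-- The game

count : Region → List Face → ℕ
count D []       = 0
count D (f ∷ fs) = if D f then suc (count D fs) else count D fs

count-mono : ∀ {D D′} → (∀ {f} → D′ f ≡ true → D f ≡ true) → ∀ fs → count D′ fs ≤ count D fs
count-mono i [] = z≤n
count-mono {D} {D′} i (f ∷ fs) with D′ f | D f | i {f}
... | true  | true  | _ = s≤s (count-mono i fs)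
... | true  | false | x = ⊥-elim (true≢false (x refl) refl)
... | false | true  | _ = m≤n⇒m≤1+n (count-mono i fs)
... | false | false | _ = count-mono i fs

count-strict : ∀ {D D′} → (∀ {f} → D′ f ≡ true → D f ≡ true) →
               ∀ {F fs} → F ∈ fs → D F ≡ true → D′ F ≡ false → count D′ fs < count D fs
count-strict i {fs = f ∷ fs} (here refl) x y rewrite x | y = s≤s (count-mono i fs)
count-strict {D} {D′} i {fs = f ∷ fs} (there k) x y with D′ f | D f | i {f}
... | true  | true  | _ = s≤s (count-strict i k x y)
... | true  | false | z = ⊥-elim (true≢false (z refl) refl)
... | false | true  | _ = m≤n⇒m≤1+n (count-strict i k x y)
... | false | false | _ = count-strict i k x y

Q-nonempty : ∀ {D p} → Q D p → ¬ (∀ f → D f ≡ false)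
Q-nonempty {D} {x , y} q empty = true≢false (proj₁ (around q (here refl))) (empty (lo (hE x y)))

Near : ℕ → ℕ → Set
Near i j = i ≤ suc j × j ≤ suc i

-- Four cops stand at the posts k ∸ 2, k ∸ 1, k and k + 1 of a guarded curve.
off : Fin 4 → ℕ → ℕ
off zero                   k = k ∸ 2
off (suc zero)             k = k ∸ 1
off (suc (suc zero))       k = k
off (suc (suc (suc zero))) k = suc k

off-≤ : ∀ m k → off m k ≤ suc k
off-≤ zero                   k = m≤n⇒m≤1+n (m∸n≤m k 2)
off-≤ (suc zero)             k = m≤n⇒m≤1+n (m∸n≤m k 1)
off-≤ (suc (suc zero))       k = n≤1+n k
off-≤ (suc (suc (suc zero))) k = ≤-refl

off-lip : ∀ m {i j} → i ≤ suc j → off m i ≤ suc (off m j)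
off-lip zero {j = j} le = ≤-trans (∸-monoˡ-≤ 2 le) (slack j)
  where
  slack : ∀ j → suc j ∸ 2 ≤ suc (j ∸ 2)
  slack zero          = z≤n
  slack (suc zero)    = z≤n
  slack (suc (suc j)) = ≤-refl
off-lip (suc zero) {j = j} le = ≤-trans (∸-monoˡ-≤ 1 le) (slack j)
  where
  slack : ∀ j → suc j ∸ 1 ≤ suc (j ∸ 1)
  slack zero    = z≤n
  slack (suc j) = ≤-refl
off-lip (suc (suc zero))       le = le
off-lip (suc (suc (suc zero))) le = s≤s le

-- The small cases are those in which truncated subtraction puts several cops on post 0.
off-hits : ∀ {k i} → k ≤ suc (suc i) → i ≤ suc k → ∃ λ m → off m k ≡ i
off-hits {zero} {zero} _ _ = zero , refl
off-hits {zero} {suc zero} _ _ = suc (suc (suc zero)) , refl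
off-hits {zero} {suc (suc i)} _ (s≤s ())
off-hits {suc zero} {zero} _ _ = zero , refl
off-hits {suc (suc zero)} {zero} _ _ = zero , refl
off-hits {suc (suc (suc k))} {zero} (s≤s (s≤s ())) _
off-hits {suc k} {suc i} x y with off-hits {k} {i} (s≤s⁻¹ x) (s≤s⁻¹ y)
... | suc (suc zero)       , eq = suc (suc zero) , cong suc eq
... | suc (suc (suc zero)) , eq = suc (suc (suc zero)) , cong suc eq
off-hits {suc zero} {suc i} x y | suc zero , refl = suc (suc zero) , refl
off-hits {suc (suc k)} {suc i} x y | suc zero , eq = suc zero , cong suc eq
off-hits {suc zero} {suc i} x y | zero , refl = suc (suc zero) , refl
off-hits {suc (suc zero)} {suc i} x y | zero , refl = suc zero , refl
off-hits {suc (suc (suc k))} {suc i} x y | zero , eq = zero , cong suc eq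

-- With `⊓-lip′`: a cop climbing one post per round towards a station that itself moves by at most
-- one never has to jump.
⊓-lip : ∀ n {s t} → s ≤ suc t → n ⊓ s ≤ suc (suc n ⊓ t)
⊓-lip n le = ⊓-mono-≤ (m≤n⇒m≤1+n (n≤1+n n)) le

⊓-lip′ : ∀ n {s t} → t ≤ suc s → suc n ⊓ t ≤ suc (n ⊓ s)
⊓-lip′ n le = ⊓-mono-≤ (≤-refl {suc n}) le

-- The pursuit by three squads of four

module Chase {G : Graph} (drawing : Drawing G) where
  open Territory drawing
  open Game G 13 hiding (V)

  Share-sym : ∀ {u v} → Share u v → Share v u
  Share-sym (p , s , t) = p , t , s

  Share-refl : ∀ v → Share v v
  Share-refl v = let p , s = inhabited v in p , s , s

  Share⇒Move : ∀ {u v} → Share u v → Move u v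
  Share⇒Move {u} {v} (p , s , t) with v Fin.≟ u
  ... | yes eq = inj₁ eq
  ... | no ne  = inj₂ (share⇒adj (ne ∘ sym) s t)

  Move⇒Share : ∀ {u v} → Move u v → Share u v
  Move⇒Share {u} (inj₁ refl) = Share-refl u
  Move⇒Share (inj₂ a)        = adj⇒share a

  lunge : ∀ {C r} i → Share (C i) r → WinC C r
  lunge {C} {r} i sh = cops target moves (caughtR (i , hit))
    where
    target : Config
    target j with j Fin.≟ i
    ... | yes _ = r
    ... | no _  = C j
    moves : CopMove C target
    moves j with j Fin.≟ i
    ... | yes refl = Share⇒Move sh
    ... | no _     = inj₁ refl
    hit : target i ≡ r
    hit with i Fin.≟ i
    ... | yes _ = refl
    ... | no ne = ⊥-elim (ne refl)

  -- Configurations are functions and are compared pointwise.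
  WinC-cong : ∀ {C C′ r} → (∀ i → C i ≡ C′ i) → WinC C r → WinC C′ r
  WinC-cong eq (caughtC (i , c))  = caughtC (i , trans (sym (eq i)) c)
  WinC-cong eq (cops C″ moves w) = cops C″ (λ i → subst (λ v → Move v (C″ i)) (eq i) (moves i)) w

  WinR-cong : ∀ {C C′ r} → (∀ i → C i ≡ C′ i) → WinR C r → WinR C′ r
  WinR-cong eq (caughtR (i , c)) = caughtR (i , trans (sym (eq i)) c)
  WinR-cong eq (robber w)        = robber λ r′ m → WinC-cong eq (w r′ m)

  -- Trails rest at the root for ever, so that cops with routes of different length can share one
  -- clock.
  record Trail (v : V) : Set where
    field
      at      : ℕ → V
      starts  : at 0 ≡ v
      shares  : ∀ k → Share (at k) (at (suc k))
      len     : ℕ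
      arrives : ∀ {k} → len ≤ k → at k ≡ root

  trail : ∀ {v} → Reach G v root → Trail v
  trail here = record
    { at = λ _ → root ; starts = refl ; shares = λ _ → Share-refl root ; len = 0 ; arrives = λ _ → refl }
  trail {v} (step a ρ) = record
    { at = λ { zero → v ; (suc k) → at k } ; starts = refl
    ; shares = λ { zero → subst (Share v) (sym starts) (adj⇒share a) ; (suc k) → shares k }
    ; len = suc len ; arrives = λ { (s≤s le) → arrives le } }
    where open Trail (trail ρ)

  share-near : (f : ℕ → V) → (∀ i → Share (f i) (f (suc i))) → ∀ {i j} → Near i j → Share (f i) (f j)
  share-near f sh {zero}        {zero}        _            = Share-refl _
  share-near f sh {zero}        {suc zero}    _            = sh 0
  share-near f sh {zero}        {suc (suc j)} (_ , s≤s ())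
  share-near f sh {suc zero}    {zero}        _            = Share-sym (sh 0)
  share-near f sh {suc (suc i)} {zero}        (s≤s () , _)
  share-near f sh {suc i}       {suc j}       (x , y)      = share-near (f ∘ suc) (sh ∘ suc) (s≤s⁻¹ x , s≤s⁻¹ y)

  post-near : ∀ {D Z} (g : Guard D Z) {i j} → Near i j → Share (Guard.post g i) (Guard.post g j)
  post-near g = share-near (Guard.post g) (Guard.post-share g)

  data Squad : Set where
    west east spare : Squad

  Role : Set
  Role = Squad × Fin 4

  station : ∀ {D Z} → Guard D Z → Fin 4 → V → V
  station g m r = Guard.post g (off m (Guard.level g r))

  level-near : ∀ {D Z} (g : Guard D Z) m {r r′} → In D r → In D r′ → Share r r′ →
               Near (off m (Guard.level g r)) (off m (Guard.level g r′))
  level-near g m i i′ sh =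
    off-lip m (Guard.level-lip g i′ i (Share-sym sh)) , off-lip m (Guard.level-lip g i i′ sh)

  station-catch : ∀ {D Z} (g : Guard D Z) {r r′ h z} → In D r → S r h → Flow D r′ h z → z ∈ Z →
                  ∃ λ m → Share (station g m r) r′
  station-catch g {r′ = r′} i s fl z∈ with Guard.catch g i s fl z∈
  ... | j , sh , lower , upper with off-hits lower upper
  ...   | m , eq = m , subst (λ k → Share (Guard.post g k) r′) (sym eq) sh

  record Siege (D : Region) {a b} (γa : Path a) (γb : Path b) (e : Edge) : Set where
    field
      disc    : Disc D γa γb e
      D⊆whole : ∀ {f} → D f ≡ true → whole f ≡ true
      strung  : Strung γa
      strung′ : Strung γb
      guardₐ  : Guard D (verts γa)
      guard-b : Guard D (verts γb)

  -- Surjectivity is all that is asked, so that thirteen cops can divide twelve roles.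
  Manned : (Fin 13 → Role) → Set
  Manned ρ = ∀ x → ∃ λ i → ρ i ≡ x

  -- Quantified over `ρ` because squads exchange their names after each cut; the spare cops may
  -- stand anywhere.
  Winning : ∀ {D a b e} {γa : Path a} {γb : Path b} → Siege D γa γb e → Set
  Winning {D} siege = ∀ (ρ : Fin 13 → Role) → Manned ρ → ∀ C r → In D r →
    (∀ i m → ρ i ≡ (west , m) → C i ≡ station guardₐ m r) →
    (∀ i m → ρ i ≡ (east , m) → C i ≡ station guard-b m r) → WinR C r
    where open Siege siege

  module Round {D a b e} {γa : Path a} {γb : Path b} (siege : Siege D γa γb e)
               (ih : ∀ {D′ a b e} {γ : Path a} {γ′ : Path b} (s : Siege D′ γ γ′ e) →
                     count D′ faces < count D faces → Winning s)
               (ρ : Fin 13 → Role) (manned : Manned ρ) where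
    open Siege siege
    open Disc disc
    open Levels disc D⊆whole strung strung′

    put : V → (Fin 4 → V) → Role → V
    put r g (west  , m) = station guardₐ m r
    put r g (east  , m) = station guard-b m r
    put r g (spare , m) = g m

    place : V → (Fin 13 → Fin 4 → V) → Config
    place r g i = put r (g i) (ρ i)

    put-share : ∀ {r r′ g g′} → In D r → In D r′ → Share r r′ → (∀ m → Share (g m) (g′ m)) →
                ∀ x → Share (put r g x) (put r′ g′ x)
    put-share i i′ sh gs (west  , m) = post-near guardₐ (level-near guardₐ m i i′ sh)
    put-share i i′ sh gs (east  , m) = post-near guard-b (level-near guard-b m i i′ sh)
    put-share i i′ sh gs (spare , m) = gs m

    by : ∀ {r r′ g} x → Share (put r (g (proj₁ (manned x))) x) r′ → WinC (place r g) r′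
    by {r} {r′} {g} x sh = lunge (proj₁ (manned x))
      (subst (λ y → Share (put r (g (proj₁ (manned x))) y) r′) (sym (proj₂ (manned x))) sh)

    -- The set `r′` contains an interior point of `D` and a point that is not interior. Walking from
    -- one to the other it first leaves the interior on a guarded path.
    escape : ∀ {r r′ g} → In D r → Share r r′ → ¬ In D r′ → WinC (place r g) r′
    escape {r} {r′} {g} i (p , s , s′) ¬i with any? (λ q → S? r′ q ×-dec ¬? (Q? D q)) box
    ... | no none = ⊥-elim (¬i (mkIn at))
      where
      at : ∀ {q} → S r′ q → Q D q
      at {q} t with Q? D q
      ... | yes x = x
      ... | no ¬x = ⊥-elim (none (lose (S⊆box t) (t , ¬x)))
    ... | yes out with find out
    ...   | q , _ , t , ¬x with leave (connected s′ t) (within i s)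
    ...     | inj₂ (x , _) = ⊥-elim (¬x x)
    ...     | inj₁ (z , inj₁ z∈ , fl) with station-catch guardₐ i s fl z∈
    ...       | m , sh = by {g = g} (west , m) sh
    escape {g = g} i (p , s , s′) ¬i | yes out | q , _ , t , ¬x | inj₁ (z , inj₂ z∈ , fl)
      with station-catch guard-b i s fl z∈
    ...       | m , sh = by {g = g} (east , m) sh

    -- The outer squads keep their stations, so leaving `D` is answered by `escape`, while the spare
    -- cops follow the schedule `g`. Here `k` is the time elapsed and `j` the time left.
    phase : (g : ℕ → V → Fin 13 → Fin 4 → V) →
            (∀ k {r r′} → In D r → In D r′ → Share r r′ → ∀ i m → Share (g k r i m) (g (suc k) r′ i m)) →
            ∀ N → (∀ r → In D r → WinR (place r (g N r)) r) →
            ∀ j k → j + k ≡ N → ∀ r → In D r → WinR (place r (g k r)) r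
    phase g gs N final zero    k refl r i = final r i
    phase g gs N final (suc j) k eq   r i = robber go
      where
      go : ∀ r′ → Move r r′ → WinC (place r (g k r)) r′
      go r′ mv with in? D r′
      ... | no ¬i  = escape {g = g k r} i (Move⇒Share mv) ¬i
      ... | yes i′ = cops (place r′ (g (suc k) r′))
        (λ x → Share⇒Move (put-share i i′ (Move⇒Share mv) (gs k i i′ (Move⇒Share mv) x) (ρ x)))
        (phase g gs N final j (suc k) (trans (+-suc j k) eq) r′ i′)

    ∂e : ∂ D e ≡ true
    ∂e rewrite bdry e | chain-∉ γa fresh | chain-∉ γb fresh′ = ≡ᵉ-refl e

    tip-face : ∃ λ F → D F ≡ true × Side F e
    tip-face with xor-true ∂e
    ... | inj₁ (x , _) = lo e , x , inj₁ refl
    ... | inj₂ (_ , x) = up e , x , inj₂ refl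

    F : Face
    F = proj₁ tip-face

    F∈D : D F ≡ true
    F∈D = proj₁ (proj₂ tip-face)

    t : Apex F e a b
    t = apex {D = D} grounded F∈D (proj₂ (proj₂ tip-face)) joins

    open Apex t using (c)

    -- Off the paths `fan` applies at `c`, and the common value around it is that of `F`.
    R-apex : ∃₂ λ k v → R k v c
    R-apex with c ∈ᵖ? verts γa | c ∈ᵖ? verts γb
    ... | yes i | _     = R-outlet (inj₁ i)
    ... | no _  | yes i = R-outlet (inj₂ i)
    ... | no i  | no k  = R-Q inner
      where
      inner : Q D c
      inner with fan D grounded c (closed-off closed i k)
      ... | β , all≡ = mkQ λ x → trans (proj₁ (all≡ x)) β≡ , trans (proj₂ (all≡ x)) β≡
        where
        e₁∈ : Apex.e₁ t ∈ inc c
        e₁∈ = Joins⇒inc (Joins-sym (Apex.joins₁ t))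
        at : Side F (Apex.e₁ t) → D F ≡ β
        at (inj₁ eq) = trans (cong D eq) (proj₁ (all≡ e₁∈))
        at (inj₂ eq) = trans (cong D eq) (proj₂ (all≡ e₁∈))
        β≡ : β ≡ true
        β≡ = trans (sym (at (Apex.side₁ t))) F∈D

    abstract
      curve : ∃ λ k → ∃ λ v → ∃ λ (γ : Path c) → Tight k v γ × Simple γ
      curve = let k , l = level-exists R-apex in k , geodesic k l

    γ : Path c
    γ = proj₁ (proj₂ (proj₂ curve))

    tight : Tight (proj₁ curve) (proj₁ (proj₂ curve)) γ
    tight = proj₁ (proj₂ (proj₂ (proj₂ curve)))

    open Cut disc F∈D (proj₂ (proj₂ tip-face)) t γ (proj₂ (proj₂ (proj₂ (proj₂ curve))))
      (Arena⇒Cl ∘ Tight-Arena tight) (tip∉Arena ∘ Tight-Arena tight)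

    abstract
      guard-c : Guard D (verts γ)
      guard-c = guard tight

    F∈faces : F ∈ faces
    F∈faces = whole⊆faces (D⊆whole F∈D)

    synced : V → Fin 13 → Fin 4 → V
    synced r i m = station guard-c m r

    spread : ∀ {D′ x x′ f p q r} {δ : Path x} {δ′ : Path x′} → Closed D′ δ δ′ f →
             (∀ {v} → S r v → v ∉ verts δ) → (∀ {v} → S r v → v ∉ verts δ′) →
             Walk (S r) p q → Q D′ p → Q D′ q
    spread cl o o′ (stop s)     x = x
    spread cl o o′ (step s j w) x = spread cl o o′ w (Q-spread cl j x (o (Walk-start w)) (o′ (Walk-start w)))

    -- The left piece lies between `γa` and `γ`, the right one between `γb` and `γ`. The squad on
    -- the path that is no longer a wall becomes spare.
    turnˡ turnʳ : Role → Role
    turnˡ (west  , m) = west  , m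
    turnˡ (east  , m) = spare , m
    turnˡ (spare , m) = east  , m
    turnʳ (west  , m) = spare , m
    turnʳ (east  , m) = west  , m
    turnʳ (spare , m) = east  , m

    mannedˡ : Manned (turnˡ ∘ ρ)
    mannedˡ (west  , m) = let i , eq = manned (west  , m) in i , cong turnˡ eq
    mannedˡ (east  , m) = let i , eq = manned (spare , m) in i , cong turnˡ eq
    mannedˡ (spare , m) = let i , eq = manned (east  , m) in i , cong turnˡ eq

    mannedʳ : Manned (turnʳ ∘ ρ)
    mannedʳ (west  , m) = let i , eq = manned (east  , m) in i , cong turnʳ eq
    mannedʳ (east  , m) = let i , eq = manned (spare , m) in i , cong turnʳ eq
    mannedʳ (spare , m) = let i , eq = manned (west  , m) in i , cong turnʳ eq

    -- By `halves` one point of the robber's set decides the piece. The set is connected and meets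
    -- none of the three paths, so `spread` carries all of it into that piece.
    narrow : ∀ r → In D r → (∀ {v} → S r v → v ∉ verts γ) → WinR (place r (synced r)) r
    narrow r i off-γ with inhabited r
    ... | p , s with halves (within i s) (off-γ s)
    ...   | inj₁ x with reduce Left.closed₁
    ...     | inj₂ empty = ⊥-elim (Q-nonempty x empty)
    ...     | inj₁ red = ih siege′ (count-strict Left.D₁⊆D F∈faces F∈D Left.F∉D₁) (turnˡ ∘ ρ) mannedˡ _ r
                (mkIn λ s′ → spread Left.closed₁ (λ t → Thin⇒∉ D {γ = γa} grounded thin (within i t)) off-γ (connected s s′) x)
                (λ k m → west-at (ρ k)) (λ k m → east-at (ρ k))
      where
      open Reduced red hiding (disc)
      siege′ : Siege Left.D₁ δ δ′ edge
      siege′ = record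
        { disc = Reduced.disc red ; D⊆whole = λ z → D⊆whole (Left.D₁⊆D z) ; strung = strung ∘ edges⊆
        ; strung′ = Tight-Strung tight ∘ edges′⊆
        ; guardₐ = Guard-mono Left.D₁⊆D δ⊆γ guardₐ ; guard-b = Guard-mono Left.D₁⊆D δ′⊆γ′ guard-c }
      west-at : ∀ {m} x → turnˡ x ≡ (west , m) → put r (λ m → station guard-c m r) x ≡ station guardₐ m r
      west-at (west , m) refl = refl
      east-at : ∀ {m} x → turnˡ x ≡ (east , m) → put r (λ m → station guard-c m r) x ≡ station guard-c m r
      east-at (spare , m) refl = refl
    narrow r i off-γ | p , s | inj₂ x with reduce Right.closed₁
    ...     | inj₂ empty = ⊥-elim (Q-nonempty x empty)
    ...     | inj₁ red = ih siege′ (count-strict Right.D₁⊆D F∈faces F∈D Right.F∉D₁) (turnʳ ∘ ρ) mannedʳ _ r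
                (mkIn λ s′ → spread Right.closed₁ (λ t → Thin⇒∉ D {γ = γb} grounded thin′ (within i t)) off-γ (connected s s′) x)
                (λ k m → west-at (ρ k)) (λ k m → east-at (ρ k))
      where
      open Reduced red hiding (disc)
      siege′ : Siege Right.D₁ δ δ′ edge
      siege′ = record
        { disc = Reduced.disc red ; D⊆whole = λ z → D⊆whole (Right.D₁⊆D z) ; strung = strung′ ∘ edges⊆
        ; strung′ = Tight-Strung tight ∘ edges′⊆
        ; guardₐ = Guard-mono Right.D₁⊆D δ⊆γ guard-b ; guard-b = Guard-mono Right.D₁⊆D δ′⊆γ′ guard-c }
      west-at : ∀ {m} x → turnʳ x ≡ (west , m) → put r (λ m → station guard-c m r) x ≡ station guard-b m r
      west-at (east , m) refl = refl
      east-at : ∀ {m} x → turnʳ x ≡ (east , m) → put r (λ m → station guard-c m r) x ≡ station guard-c m r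
      east-at (spare , m) refl = refl

    -- When the spare squad gets into position the robber may be touching `γ`. One more round
    -- settles it: a set that meets `γ` after his move is caught, otherwise the region is cut.
    endgame : ∀ r → In D r → WinR (place r (synced r)) r
    endgame r i = robber go
      where
      go : ∀ r′ → Move r r′ → WinC (place r (synced r)) r′
      go r′ mv with in? D r′ | Move⇒Share mv
      ... | no ¬i  | sh = escape {g = synced r} i sh ¬i
      ... | yes i′ | sh@(p , s , s′) with any? (S? r′) (verts γ)
      ...   | yes hit with find hit
      ...     | z , z∈ , t with station-catch guard-c i s (flow-in i′ (connected s′ t)) z∈
      ...       | m , sh′ = by {g = synced r} (spare , m) sh′
      go r′ mv | yes i′ | sh@(p , s , s′) | no miss =
        cops (place r′ (synced r′))
             (λ x → Share⇒Move (put-share i i′ sh (λ m → post-near guard-c (level-near guard-c m i i′ sh)) (ρ x)))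
             (narrow r′ i′ λ t v∈ → miss (lose v∈ t))

    -- No station lies beyond post B + 1, so the length of the march can be fixed in advance,
    -- whatever the robber does.
    bound : ∃ λ B → ∀ r → Guard.level guard-c r ≤ B
    bound = fin-bound (Guard.level guard-c)

    -- The spare cops start together at post 0, which is the root, and climb the curve until the
    -- minimum is the moving station.
    marching : ℕ → V → Fin 13 → Fin 4 → V
    marching k r i m = Guard.post guard-c (k ⊓ off m (Guard.level guard-c r))

    place-cong : ∀ {r g g′} → (∀ i m → g i m ≡ g′ i m) → ∀ i → place r g i ≡ place r g′ i
    place-cong {r} {g} {g′} eq i = at (ρ i)
      where
      at : ∀ x → put r (g i) x ≡ put r (g′ i) x
      at (west  , m) = refl
      at (east  , m) = refl
      at (spare , m) = eq i m

    marched : ∀ r → In D r → WinR (place r (marching 0 r)) r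
    marched r i = phase marching
      (λ k i i′ sh j m → let (x , y) = level-near guard-c m i i′ sh in post-near guard-c (⊓-lip k x , ⊓-lip′ k y))
      (suc (proj₁ bound))
      (λ r i → WinR-cong (place-cong {r} λ j m → sym (cong (Guard.post guard-c)
                  (m≥n⇒m⊓n≡n (≤-trans (off-≤ m _) (s≤s (proj₂ bound r)))))) (endgame r i))
      (suc (proj₁ bound)) 0 (+-identityʳ _) r i

    module _ (C : Config) where
      trails : ∀ i → Trail (C i)
      trails i = trail (reach-root (C i))

      longest : ∃ λ B → ∀ i → Trail.len (trails i) ≤ B
      longest = fin-bound (λ i → Trail.len (trails i))

      -- Brings every spare cop, wherever it stands, to the root, where the posts of the new curve
      -- begin.
      gathering : ℕ → V → Fin 13 → Fin 4 → V
      gathering k r i m = Trail.at (trails i) k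

      gathered : ∀ r → In D r → WinR (place r (gathering 0 r)) r
      gathered r i = phase gathering (λ k _ _ _ j m → Trail.shares (trails j) k) (proj₁ longest)
        (λ r i → WinR-cong (place-cong {r} λ j m →
                   trans (Guard.post-root guard-c) (sym (Trail.arrives (trails j) (proj₂ longest j)))) (marched r i))
        (proj₁ longest) 0 (+-identityʳ _) r i

  win : ∀ {D a b e} {γa : Path a} {γb : Path b} (siege : Siege D γa γb e) → Acc _<_ (count D faces) → Winning siege
  win siege (acc rs) ρ manned C r i at-west at-east =
    WinR-cong (λ j → at j (ρ j) refl) (gathered C r i)
    where
    open Round siege (λ s lt → win s (rs lt)) ρ manned
    at : ∀ j x → ρ j ≡ x → put r (gathering C 0 r j) x ≡ C j
    at j (west  , m) eq = sym (at-west j m eq)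
    at j (east  , m) eq = sym (at-east j m eq)
    at j (spare , m) eq = Trail.starts (trails C j)

-- The frame of a grid

Walk-trans : ∀ {P p q r} → Walk P p q → Walk P q r → Walk P p r
Walk-trans (stop _)     w = w
Walk-trans (step x j v) w = step x j (Walk-trans v w)

Walk-sym : ∀ {P p q} → Walk P p q → Walk P q p
Walk-sym (stop x)     = stop x
Walk-sym (step x j w) = Walk-trans (Walk-sym w) (step (Walk-start w) (Joins-sym j) (stop x))

walk-left : ∀ {P : Pt → Set} {y} x {x′} → x ≤ x′ → (∀ {i} → x ≤ i → i ≤ x′ → P (i , y)) → Walk P (x′ , y) (x , y)
walk-left x {zero}   z≤n  on = stop (on z≤n z≤n)
walk-left {P} {y} x {suc x′} x≤x′ on with x ≤? x′
... | yes le = step {e = hE x′ y} (on x≤x′ ≤-refl) (inj₂ (refl , refl)) (walk-left x le λ a b → on a (m≤n⇒m≤1+n b))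
... | no ¬le with refl ← ≤-antisym x≤x′ (≰⇒> ¬le) = stop (on ≤-refl ≤-refl)

walk-down : ∀ {P : Pt → Set} {x} y {y′} → y ≤ y′ → (∀ {i} → y ≤ i → i ≤ y′ → P (x , i)) → Walk P (x , y′) (x , y)
walk-down y {zero}   z≤n  on = stop (on z≤n z≤n)
walk-down {P} {x} y {suc y′} y≤y′ on with y ≤? y′
... | yes le = step {e = vE x y′} (on y≤y′ ≤-refl) (inj₂ (refl , refl)) (walk-down y le λ a b → on a (m≤n⇒m≤1+n b))
... | no ¬le with refl ← ≤-antisym y≤y′ (≰⇒> ¬le) = stop (on ≤-refl ≤-refl)

fin-argmin : ∀ {k} (f : Fin (suc k) → ℕ) → ∃ λ i → ∀ j → f i ≤ f j
fin-argmin {zero}  f = zero , λ { zero → ≤-refl }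
fin-argmin {suc k} f with fin-argmin (f ∘ suc)
... | i , min with f zero ≤? f (suc i)
...   | yes le = zero , λ { zero → ≤-refl ; (suc j) → ≤-trans le (min j) }
...   | no gt  = suc i , λ { zero → ≰⇒≥ gt ; (suc j) → min j }

argmin : ∀ {k} → Fin k → (f : Fin k → ℕ) → ∃ λ i → ∀ j → f i ≤ f j
argmin {suc k} _ = fin-argmin

<ᵇ-step : ∀ k y → ((k ≡ᵇ y) xor (y <ᵇ k)) ≡ (y <ᵇ suc k)
<ᵇ-step zero    zero    = refl
<ᵇ-step zero    (suc y) = refl
<ᵇ-step (suc k) zero    = refl
<ᵇ-step (suc k) (suc y) = <ᵇ-step k y

<ᵇ-drop : ∀ y k → ((y <ᵇ k) xor (y <ᵇ suc k)) ≡ (y ≡ᵇ k)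
<ᵇ-drop zero    zero    = refl
<ᵇ-drop zero    (suc k) = refl
<ᵇ-drop (suc y) zero    = refl
<ᵇ-drop (suc y) (suc k) = <ᵇ-drop y k

≡ᵇ-sym : ∀ m k → (m ≡ᵇ k) ≡ (k ≡ᵇ m)
≡ᵇ-sym zero    zero    = refl
≡ᵇ-sym zero    (suc k) = refl
≡ᵇ-sym (suc m) zero    = refl
≡ᵇ-sym (suc m) (suc k) = ≡ᵇ-sym m k

<ᵇ-true : ∀ {m k} → m < k → (m <ᵇ k) ≡ true
<ᵇ-true {zero}  (s≤s _)  = refl
<ᵇ-true {suc m} (s≤s lt) = <ᵇ-true lt

<ᵇ-false : ∀ {m k} → k ≤ m → (m <ᵇ k) ≡ false
<ᵇ-false {m}     z≤n      = refl
<ᵇ-false {suc m} (s≤s le) = <ᵇ-false le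

<ᵇ-sound : ∀ m k → (m <ᵇ k) ≡ true → m < k
<ᵇ-sound zero    (suc k) _  = s≤s z≤n
<ᵇ-sound (suc m) (suc k) eq = s≤s (<ᵇ-sound m k eq)

-- The outer frame of the grid [0 , X] × [0 , Y] with X = X₀ + 1 and Y = Y₀ + 1, cut at its
-- right edge below the corner (X , Y) into two paths to the origin.
module Frame (X₀ Y₀ : ℕ) where
  X Y : ℕ
  X = suc X₀
  Y = suc Y₀

  cell : ℕ → ℕ → Bool
  cell x y = (x <ᵇ X) ∧ (y <ᵇ Y)

  D₀ : Region
  D₀ (Lo zero    y) = false
  D₀ (Lo (suc x) y) = cell x y
  D₀ (Up x zero)    = false
  D₀ (Up x (suc y)) = cell x y

  tip : Edge
  tip = vE X Y₀

  left : ∀ y → Path (0 , y)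
  left zero    = end
  left (suc y) = step (vE 0 y) (inj₂ (refl , refl)) (left y)

  top : ∀ x → Path (x , Y)
  top zero    = left Y
  top (suc x) = step (hE x Y) (inj₂ (refl , refl)) (top x)

  bottom : ∀ x → Path (x , 0)
  bottom zero    = end
  bottom (suc x) = step (hE x 0) (inj₂ (refl , refl)) (bottom x)

  right : ∀ y → Path (X , y)
  right zero    = bottom X
  right (suc y) = step (vE X y) (inj₂ (refl , refl)) (right y)

  -- Closed forms of the chains of the four sides, against which the boundary of `D₀` can be
  -- compared edge by edge.
  leftC topC bottomC rightC : ℕ → Chain
  leftC k (vE x y) = (0 ≡ᵇ x) ∧ (y <ᵇ k)
  leftC k _        = false
  topC k (hE x y) = (x <ᵇ k) ∧ (Y ≡ᵇ y)
  topC k _        = false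
  bottomC k (hE x y) = (x <ᵇ k) ∧ (0 ≡ᵇ y)
  bottomC k _        = false
  rightC k (vE x y) = (X ≡ᵇ x) ∧ (y <ᵇ k)
  rightC k _        = false

  chain-left : ∀ k e → chain (left k) e ≡ leftC k e
  chain-left zero    (hE x y) = refl
  chain-left zero    (vE x y) = sym (∧-zeroʳ (0 ≡ᵇ x))
  chain-left zero    (dE x y) = refl
  chain-left (suc k) (hE x y) = chain-left k (hE x y)
  chain-left (suc k) (dE x y) = chain-left k (dE x y)
  chain-left (suc k) (vE x y) = trans (cong (((0 ≡ᵇ x) ∧ (k ≡ᵇ y)) xor_) (chain-left k (vE x y)))
    (trans (sym (∧-distribˡ-xor (0 ≡ᵇ x) (k ≡ᵇ y) (y <ᵇ k))) (cong ((0 ≡ᵇ x) ∧_) (<ᵇ-step k y)))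

  chain-top : ∀ k e → chain (top k) e ≡ topC k e xor leftC Y e
  chain-top zero    (hE x y) = chain-left Y (hE x y)
  chain-top zero    (vE x y) = chain-left Y (vE x y)
  chain-top zero    (dE x y) = chain-left Y (dE x y)
  chain-top (suc k) (vE x y) = chain-top k (vE x y)
  chain-top (suc k) (dE x y) = chain-top k (dE x y)
  chain-top (suc k) (hE x y) = trans (cong (((k ≡ᵇ x) ∧ (Y ≡ᵇ y)) xor_) (chain-top k (hE x y)))
    (trans (sym (xor-assoc ((k ≡ᵇ x) ∧ (Y ≡ᵇ y)) _ _))
    (cong (_xor false) (trans (sym (∧-distribʳ-xor (Y ≡ᵇ y) (k ≡ᵇ x) (x <ᵇ k))) (cong (_∧ (Y ≡ᵇ y)) (<ᵇ-step k x)))))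

  chain-bottom : ∀ k e → chain (bottom k) e ≡ bottomC k e
  chain-bottom zero    (hE x y) = refl
  chain-bottom zero    (vE x y) = refl
  chain-bottom zero    (dE x y) = refl
  chain-bottom (suc k) (vE x y) = chain-bottom k (vE x y)
  chain-bottom (suc k) (dE x y) = chain-bottom k (dE x y)
  chain-bottom (suc k) (hE x y) = trans (cong (((k ≡ᵇ x) ∧ (0 ≡ᵇ y)) xor_) (chain-bottom k (hE x y)))
    (trans (sym (∧-distribʳ-xor (0 ≡ᵇ y) (k ≡ᵇ x) (x <ᵇ k))) (cong (_∧ (0 ≡ᵇ y)) (<ᵇ-step k x)))

  chain-right : ∀ k e → chain (right k) e ≡ rightC k e xor bottomC X e
  chain-right zero    (hE x y) = chain-bottom X (hE x y)
  chain-right zero    (vE x y) = trans (chain-bottom X (vE x y)) (sym (cong (_xor false) (∧-zeroʳ (X ≡ᵇ x))))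
  chain-right zero    (dE x y) = chain-bottom X (dE x y)
  chain-right (suc k) (hE x y) = chain-right k (hE x y)
  chain-right (suc k) (dE x y) = chain-right k (dE x y)
  chain-right (suc k) (vE x y) = trans (cong (((X ≡ᵇ x) ∧ (k ≡ᵇ y)) xor_) (chain-right k (vE x y)))
    (trans (sym (xor-assoc ((X ≡ᵇ x) ∧ (k ≡ᵇ y)) _ _))
    (cong (_xor false) (trans (sym (∧-distribˡ-xor (X ≡ᵇ x) (k ≡ᵇ y) (y <ᵇ k))) (cong ((X ≡ᵇ x) ∧_) (<ᵇ-step k y)))))

  grounded₀ : Grounded D₀
  grounded₀ = (λ _ → refl) , (λ _ → refl)

  bdry₀ : ∀ e → ∂ D₀ e ≡ (chain (top X) e xor chain (right Y₀) e) xor (tip ≡ᵉ e)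
  bdry₀ e rewrite chain-top X e | chain-right Y₀ e = go e
    where
    go : ∀ e → ∂ D₀ e ≡ ((topC X e xor leftC Y e) xor (rightC Y₀ e xor bottomC X e)) xor (tip ≡ᵉ e)
    go (hE x zero) rewrite ∧-zeroʳ (x <ᵇ X) = refl
    go (hE x (suc y)) = trans (sym (∧-distribˡ-xor (x <ᵇ X) (y <ᵇ Y₀) (y <ᵇ Y))) (trans
      (cong ((x <ᵇ X) ∧_) (trans (<ᵇ-drop y Y₀) (≡ᵇ-sym y Y₀)))
      (tidy ((x <ᵇ X) ∧ (Y₀ ≡ᵇ y)) (x <ᵇ X)))
      where
      tidy : ∀ a b → a ≡ ((a xor false) xor (b ∧ false)) xor false
      tidy true  true  = refl
      tidy true  false = refl
      tidy false true  = refl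
      tidy false false = refl
    go (vE zero y) = sym (trans (xor-identityʳ _) (xor-identityʳ _))
    go (vE (suc x) y) = trans (sym (∧-distribʳ-xor (y <ᵇ Y) (x <ᵇ X) (x <ᵇ X₀))) (trans
      (cong (_∧ (y <ᵇ Y)) (trans (Bool.xor-comm (x <ᵇ X) (x <ᵇ X₀)) (trans (<ᵇ-drop x X₀) (≡ᵇ-sym x X₀))))
      (trans (cong ((X₀ ≡ᵇ x) ∧_) (sym (<ᵇ-step Y₀ y))) (tidy (X₀ ≡ᵇ x) (Y₀ ≡ᵇ y) (y <ᵇ Y₀))))
      where
      tidy : ∀ a b c → a ∧ (b xor c) ≡ ((a ∧ c) xor false) xor (a ∧ b)
      tidy true  true  true  = refl
      tidy true  true  false = refl
      tidy true  false true  = refl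
      tidy true  false false = refl
      tidy false b     c     = refl
    go (dE x y) = xor-same (cell x y)

  verts-left : ∀ k {x y} → (x , y) ∈ verts (left k) → x ≡ 0 × y ≤ k
  verts-left zero    (here refl) = refl , z≤n
  verts-left (suc k) (here refl) = refl , ≤-refl
  verts-left (suc k) (there i)   = proj₁ (verts-left k i) , m≤n⇒m≤1+n (proj₂ (verts-left k i))

  verts-top : ∀ k {x y} → (x , y) ∈ verts (top k) → x ≤ k × (x ≡ 0 ⊎ y ≡ Y) × y ≤ Y
  verts-top zero    i with verts-left Y i
  ... | refl , y≤ = z≤n , inj₁ refl , y≤
  verts-top (suc k) (here refl) = ≤-refl , inj₂ refl , ≤-refl
  verts-top (suc k) (there i) with verts-top k i
  ... | x≤ , on , y≤ = m≤n⇒m≤1+n x≤ , on , y≤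

  verts-bottom : ∀ k {x y} → (x , y) ∈ verts (bottom k) → x ≤ k × y ≡ 0
  verts-bottom zero    (here refl) = z≤n , refl
  verts-bottom (suc k) (here refl) = ≤-refl , refl
  verts-bottom (suc k) (there i)   = m≤n⇒m≤1+n (proj₁ (verts-bottom k i)) , proj₂ (verts-bottom k i)

  verts-right : ∀ k {x y} → (x , y) ∈ verts (right k) → y ≤ k × (x ≡ X ⊎ y ≡ 0) × x ≤ X
  verts-right zero    i with verts-bottom X i
  ... | x≤ , refl = z≤n , inj₂ refl , x≤
  verts-right (suc k) (here refl) = ≤-refl , inj₁ refl , ≤-refl
  verts-right (suc k) (there i) with verts-right k i
  ... | y≤ , on , x≤ = m≤n⇒m≤1+n y≤ , on , x≤

  simple-left : ∀ k → Simple (left k)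
  simple-left zero    = tt
  simple-left (suc k) = (λ i → 1+n≰n (proj₂ (verts-left k i))) , simple-left k

  simple-top : ∀ k → Simple (top k)
  simple-top zero    = simple-left Y
  simple-top (suc k) = (λ i → 1+n≰n (proj₁ (verts-top k i))) , simple-top k

  simple-bottom : ∀ k → Simple (bottom k)
  simple-bottom zero    = tt
  simple-bottom (suc k) = (λ i → 1+n≰n (proj₁ (verts-bottom k i))) , simple-bottom k

  simple-right : ∀ k → Simple (right k)
  simple-right zero    = simple-bottom X
  simple-right (suc k) = (λ i → 1+n≰n (proj₁ (verts-right k i))) , simple-right k

  outside-x : ∀ x y → X ≤ x → cell x y ≡ false
  outside-x x y le rewrite <ᵇ-false le = refl

  outside-y : ∀ x y → Y ≤ y → cell x y ≡ false
  outside-y x y le rewrite <ᵇ-false le = ∧-zeroʳ (x <ᵇ X)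

  thin-left : ∀ k → Thin D₀ (left k)
  thin-left (suc k) (here refl) () _
  thin-left (suc k) (there i)   = thin-left k i

  thin-top : ∀ k → Thin D₀ (top k)
  thin-top zero    i = thin-left Y i
  thin-top (suc k) (here refl) x _ = true≢false x (outside-y k Y ≤-refl)
  thin-top (suc k) (there i)   = thin-top k i

  thin-bottom : ∀ k → Thin D₀ (bottom k)
  thin-bottom (suc k) (here refl) _ ()
  thin-bottom (suc k) (there i)   = thin-bottom k i

  thin-right : ∀ k → Thin D₀ (right k)
  thin-right zero    i = thin-bottom X i
  thin-right (suc k) (here refl) _ x = true≢false x (outside-x X k ≤-refl)
  thin-right (suc k) (there i)   = thin-right k i

  -- Outside the frame `φ` is constant across all edges. Columns to the right of the frame are
  -- climbed from the axis (`beyond`); faces above it are reached by going right to such a column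
  -- (`above`), since their own column passes through `D₀`.
  maximal₀ : Maximal D₀ (top X) (right Y₀)
  maximal₀ φ (g , h) ∂φ {f} φf with D₀ f in D₀f
  ... | true  = refl
  ... | false = ⊥-elim (true≢false φf (outside f D₀f))
    where
    quiet : ∀ e → topC X e xor leftC Y e ≡ false → rightC Y₀ e xor bottomC X e ≡ false →
            D₀ (lo e) ≡ false → D₀ (up e) ≡ false → φ (lo e) ≡ φ (up e)
    quiet e a b l u = xor-false⇒≡ (not-true λ eq → no-cl (∂φ {e} eq))
      where
      no-cl : ¬ Cl D₀ (top X) (right Y₀) e
      no-cl (inj₁ (inj₁ i)) = true≢false (chain-∈ (top X) (simple-top X) i) (trans (chain-top X e) a)
      no-cl (inj₁ (inj₂ i)) = true≢false (chain-∈ (right Y₀) (simple-right Y₀) i) (trans (chain-right Y₀ e) b)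
      no-cl (inj₂ (inj₁ x)) = true≢false x l
      no-cl (inj₂ (inj₂ x)) = true≢false x u

    beyond : ∀ x y → X ≤ x → φ (Up x y) ≡ false × φ (Lo (suc x) y) ≡ false
    beyond x zero X≤x = h x , trans (quiet (hE x 0) (off-top 0) (off-bottom 0) (outside-x x 0 X≤x) refl) (h x)
      where
      off-top : ∀ y → ((x <ᵇ X) ∧ (Y ≡ᵇ y)) xor false ≡ false
      off-top y rewrite <ᵇ-false X≤x = refl
      off-bottom : ∀ y → (x <ᵇ X) ∧ (0 ≡ᵇ y) ≡ false
      off-bottom y rewrite <ᵇ-false X≤x = refl
    beyond x (suc y) X≤x = up≡ , trans (quiet (hE x (suc y)) off-top off-bottom (outside-x x (suc y) X≤x) (outside-x x y X≤x)) up≡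
      where
      off-top : ((x <ᵇ X) ∧ (Y ≡ᵇ suc y)) xor false ≡ false
      off-top rewrite <ᵇ-false X≤x = refl
      off-bottom : (x <ᵇ X) ∧ false ≡ false
      off-bottom = ∧-zeroʳ (x <ᵇ X)
      up≡ : φ (Up x (suc y)) ≡ false
      up≡ = trans (sym (quiet (dE x y) refl refl (outside-x x y X≤x) (outside-x x y X≤x))) (proj₂ (beyond x y X≤x))

    above : ∀ k x y → k + x ≡ X → Y ≤ y → φ (Up x (suc y)) ≡ false × φ (Lo (suc x) y) ≡ false
    above zero x y refl Y≤y = proj₁ (beyond X (suc y) ≤-refl) , proj₂ (beyond X y ≤-refl)
    above (suc k) x y eq Y≤y = trans (sym (quiet (dE x y) refl refl (outside-y x y Y≤y) (outside-y x y Y≤y))) lo≡ , lo≡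
      where
      off-right : ((X₀ ≡ᵇ x) ∧ (y <ᵇ Y₀)) xor false ≡ false
      off-right rewrite <ᵇ-false (≤-trans (n≤1+n Y₀) Y≤y) | ∧-zeroʳ (X₀ ≡ᵇ x) = refl
      lo≡ : φ (Lo (suc x) y) ≡ false
      lo≡ = trans (quiet (vE (suc x) y) refl off-right (outside-y x y Y≤y) (outside-y (suc x) y Y≤y))
                  (proj₁ (above k (suc x) y (trans (+-suc k x) eq) Y≤y))

    outside : ∀ f → D₀ f ≡ false → φ f ≡ false
    outside (Lo zero y) _ = g y
    outside (Up x zero) _ = h x
    outside (Lo (suc x) y) d with X ≤? x | Y ≤? y
    ... | yes le | _      = proj₂ (beyond x y le)
    ... | no lt  | yes le = proj₂ (above (X ∸ x) x y (m∸n+n≡m (<⇒≤ (≰⇒> lt))) le)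
    ... | no lt  | no lt′ = ⊥-elim (true≢false (cong₂ _∧_ (<ᵇ-true (≰⇒> lt)) (<ᵇ-true (≰⇒> lt′))) d)
    outside (Up x (suc y)) d with X ≤? x | Y ≤? y
    ... | yes le | _      = proj₁ (beyond x (suc y) le)
    ... | no lt  | yes le = proj₁ (above (X ∸ x) x y (m∸n+n≡m (<⇒≤ (≰⇒> lt))) le)
    ... | no lt  | no lt′ = ⊥-elim (true≢false (cong₂ _∧_ (<ᵇ-true (≰⇒> lt)) (<ᵇ-true (≰⇒> lt′))) d)

  disc₀ : Disc D₀ (top X) (right Y₀) tip
  disc₀ = record
    { closed = record
      { between = record
        { grounded = grounded₀ ; thin = thin-top X ; thin′ = thin-right Y₀
        ; simple = simple-top X ; simple′ = simple-right Y₀ ; maximal = maximal₀ }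
      ; joins = inj₂ (refl , refl) ; bdry = bdry₀ }
    ; fresh = λ i → true≢false (chain-∈ (top X) (simple-top X) i) (chain-top X tip)
    ; fresh′ = λ i → 1+n≰n (proj₁ (verts-right Y₀ (ends∈verts (right Y₀) i (inj₂ (refl , refl))))) }

  grid : List Pt
  grid = cartesianProduct (upTo (suc X)) (upTo (suc Y))

  ∈-grid : ∀ {x y} → x ≤ X → y ≤ Y → (x , y) ∈ grid
  ∈-grid x≤X y≤Y = ∈-cartesianProduct⁺ (∈-upTo⁺ (s≤s x≤X)) (∈-upTo⁺ (s≤s y≤Y))

  cell-bounds : ∀ {x y} → cell x y ≡ true → x < X × y < Y
  cell-bounds {x} {y} eq = <ᵇ-sound x X (proj₁ (∧-split eq)) , <ᵇ-sound y Y (proj₂ (∧-split eq))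

  Q⇒grid : ∀ {p} → Q D₀ p → p ∈ grid
  Q⇒grid q with cell-bounds (proj₁ (around q (here refl)))
  ... | x<X , y<Y = ∈-grid (<⇒≤ x<X) (<⇒≤ y<Y)

  interior : ∀ {x y} → x < X₀ → y < Y₀ → Q D₀ (suc x , suc y)
  interior {x} {y} x<X₀ y<Y₀ = mkQ λ
    { (here refl) → cells x< y< , cells x< y<′
    ; (there (here refl)) → cells x<′ y< , cells x< y<
    ; (there (there (here refl))) → cells x< y< , cells x< y<
    ; (there (there (there (here refl)))) → cells x<′ y< , cells x<′ y<′
    ; (there (there (there (there (here refl))))) → cells x<′ y<′ , cells x< y<′
    ; (there (there (there (there (there (here refl)))))) → cells x<′ y<′ , cells x<′ y<′ }
    where
    x< = s≤s x<X₀
    y< = s≤s y<Y₀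
    x<′ = m≤n⇒m≤1+n x<X₀
    y<′ = m≤n⇒m≤1+n y<Y₀
    cells : ∀ {i j} → i < X → j < Y → cell i j ≡ true
    cells i j = cong₂ _∧_ (<ᵇ-true i) (<ᵇ-true j)

  all-faces : List Face
  all-faces = map (uncurry Lo) grid ++ map (uncurry (λ x y → Up x (suc y))) grid

  D₀⊆faces : ∀ {f} → D₀ f ≡ true → f ∈ all-faces
  D₀⊆faces {Lo (suc x) y} d with cell-bounds d
  ... | x<X , y<Y = ∈-++⁺ˡ (∈-map⁺ (uncurry Lo) (∈-grid x<X (<⇒≤ y<Y)))
  D₀⊆faces {Up x (suc y)} d with cell-bounds d
  ... | x<X , y<Y = ∈-++⁺ʳ (map (uncurry Lo) grid) (∈-map⁺ (uncurry (λ x y → Up x (suc y))) (∈-grid (<⇒≤ x<X) (<⇒≤ y<Y)))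

-- From rectangles to the grid

module Boxes {G : Graph} (reach : ∀ u v → Reach G u v) (v₀ : Fin (n G))
             (l r b t : Fin (n G) → ℕ) (X₀ Y₀ : ℕ)
             (l≤r : ∀ v → l v ≤ r v) (b≤t : ∀ v → b v ≤ t v)
             (0<l : ∀ v → 0 < l v) (0<b : ∀ v → 0 < b v)
             (r≤X₀ : ∀ v → r v ≤ X₀) (t≤Y₀ : ∀ v → t v ≤ Y₀) where

  Overlap : Fin (n G) → Fin (n G) → Set
  Overlap u v = (l u ≤ r v × l v ≤ r u) × (b u ≤ t v × b v ≤ t u)

  module _ (adj⇒overlap : ∀ {u v} → Adj G u v → Overlap u v)
           (overlap⇒adj : ∀ {u v} → u ≢ v → Overlap u v → Adj G u v) where
    open Frame X₀ Y₀

    V : Set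
    V = Fin (n G)

    Cov : V → Pt → Set
    Cov v p = (l v ≤ proj₁ p × proj₁ p ≤ r v) × (b v ≤ proj₂ p × proj₂ p ≤ t v)

    cov? : ∀ v p → Dec (Cov v p)
    cov? v p = (l v ≤? proj₁ p ×-dec proj₁ p ≤? r v) ×-dec (b v ≤? proj₂ p ×-dec proj₂ p ≤? t v)

    -- The root owns the frame, so it must be connected to it: nothing covers the points below the
    -- lowest rectangle, which therefore fall to the frame.
    lowest : ∃ λ v → ∀ u → b v ≤ b u
    lowest = argmin v₀ b

    root : V
    root = proj₁ lowest

    -- The owner of a point: uncovered points fall down to a rectangle or to the bottom of
    -- the frame, and the frame belongs to the lowest rectangle.
    own : ℕ → ℕ → V
    own x zero = root
    own x (suc y) with Y ≤? suc y | Fin.any? (λ v → cov? v (x , suc y))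
    ... | yes _ | _           = root
    ... | no _  | yes (v , _) = v
    ... | no _  | no _        = own x y

    S : V → Pt → Set
    S v p = (proj₁ p ≤ X × proj₂ p ≤ Y) × (Cov v p ⊎ own (proj₁ p) (proj₂ p) ≡ v)

    S? : ∀ v p → Dec (S v p)
    S? v p = (proj₁ p ≤? X ×-dec proj₂ p ≤? Y) ×-dec (cov? v p ⊎-dec (own (proj₁ p) (proj₂ p) Fin.≟ v))

    -- A covered point goes to a rectangle that covers it, so the enlarged sets of distinct vertices
    -- meet only if the vertices are adjacent.
    own-cov : ∀ {v} x y → Cov v (x , y) → Cov (own x y) (x , y)
    own-cov {v} x zero    (_ , b≤ , _) = ⊥-elim (<-irrefl refl (≤-trans (0<b v) b≤))
    own-cov {v} x (suc y) c with Y ≤? suc y | Fin.any? (λ v → cov? v (x , suc y))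
    ... | yes Y≤ | _            = ⊥-elim (<-irrefl refl (≤-trans Y≤ (≤-trans (proj₂ (proj₂ c)) (t≤Y₀ v))))
    ... | no _   | yes (_ , c′) = c′
    ... | no _   | no none      = ⊥-elim (none (v , c))

    own-uncovered : ∀ x y → (∀ v i → i ≤ y → ¬ Cov v (x , i)) → own x y ≡ root
    own-uncovered x zero    none = refl
    own-uncovered x (suc y) none with Y ≤? suc y | Fin.any? (λ v → cov? v (x , suc y))
    ... | yes _ | _           = refl
    ... | no _  | yes (v , c) = ⊥-elim (none v (suc y) ≤-refl c)
    ... | no _  | no _        = own-uncovered x y λ v i i≤y → none v i (m≤n⇒m≤1+n i≤y)

    own-left : ∀ y → own 0 y ≡ root
    own-left y = own-uncovered 0 y λ v i _ c → <-irrefl refl (≤-trans (0<l v) (proj₁ (proj₁ c)))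

    own-right : ∀ y → own X y ≡ root
    own-right y = own-uncovered X y λ v i _ c → <-irrefl refl (≤-trans (proj₂ (proj₁ c)) (r≤X₀ v))

    own-top : ∀ x → own x Y ≡ root
    own-top x with Y ≤? Y | Fin.any? (λ v → cov? v (x , Y))
    ... | yes _ | _ = refl
    ... | no ¬p | _ = ⊥-elim (¬p ≤-refl)

    common-overlap : ∀ {u v p} → Cov u p → Cov v p → Overlap u v
    common-overlap ((a , b) , c , d) ((a′ , b′) , c′ , d′) =
      (≤-trans a b′ , ≤-trans a′ b) , ≤-trans c d′ , ≤-trans c′ d

    share⇒adj : ∀ {u v p} → u ≢ v → S u p → S v p → Adj G u v
    share⇒adj ne (_ , inj₁ c)    (_ , inj₁ c′)   = overlap⇒adj ne (common-overlap c c′)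
    share⇒adj ne (_ , inj₁ c)    (_ , inj₂ refl) = overlap⇒adj ne (common-overlap c (own-cov _ _ c))
    share⇒adj ne (_ , inj₂ refl) (_ , inj₁ c)    = overlap⇒adj ne (common-overlap (own-cov _ _ c) c)
    share⇒adj ne (_ , inj₂ refl) (_ , inj₂ refl) = ⊥-elim (ne refl)

    Cov⇒S : ∀ {v p} → Cov v p → S v p
    Cov⇒S {v} c = (m≤n⇒m≤1+n (≤-trans (proj₂ (proj₁ c)) (r≤X₀ v)) , m≤n⇒m≤1+n (≤-trans (proj₂ (proj₂ c)) (t≤Y₀ v))) , inj₁ c

    adj⇒share : ∀ {u v} → Adj G u v → ∃ λ p → S u p × S v p
    adj⇒share {u} {v} a with adj⇒overlap a
    ... | (x , x′) , y , y′ = (l u ⊔ l v , b u ⊔ b v)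
      , Cov⇒S ((m≤m⊔n (l u) (l v) , ⊔-lub (l≤r u) x′) , m≤m⊔n (b u) (b v) , ⊔-lub (b≤t u) y′)
      , Cov⇒S ((m≤n⊔m (l u) (l v) , ⊔-lub x (l≤r v)) , m≤n⊔m (b u) (b v) , ⊔-lub y (b≤t v))

    base : V → Pt
    base v = l v , b v

    base∈ : ∀ v → S v (base v)
    base∈ v = Cov⇒S ((≤-refl , l≤r v) , ≤-refl , b≤t v)

    cov-walk : ∀ {v x y} → Cov v (x , y) → Walk (S v) (x , y) (base v)
    cov-walk {v} {x} {y} ((l≤x , x≤r) , b≤y , y≤t) = Walk-trans
      (walk-left (l v) l≤x λ l≤i i≤x → Cov⇒S ((l≤i , ≤-trans i≤x x≤r) , b≤y , y≤t))
      (walk-down (b v) b≤y λ b≤i i≤y → Cov⇒S ((≤-refl , l≤r v) , b≤i , ≤-trans i≤y y≤t))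

    below-root : Walk (S root) (base root) (l root , 0)
    below-root = walk-down 0 z≤n λ {i} _ i≤b →
      (m≤n⇒m≤1+n (≤-trans (l≤r root) (r≤X₀ root)) , m≤n⇒m≤1+n (≤-trans i≤b (≤-trans (b≤t root) (t≤Y₀ root)))) , at i i≤b
      where
      at : ∀ i → i ≤ b root → Cov root (l root , i) ⊎ own (l root) i ≡ root
      at i i≤b with i ≟ b root
      ... | yes refl = inj₁ ((≤-refl , l≤r root) , ≤-refl , b≤t root)
      ... | no ne    = inj₂ (own-uncovered (l root) i λ v j j≤i c →
                         <-irrefl refl (≤-<-trans (≤-trans (proj₂ lowest v) (proj₁ (proj₂ c))) (≤-<-trans j≤i (≤∧≢⇒< i≤b ne))))

    bottom-walk : ∀ {x} → x ≤ X → Walk (S root) (x , 0) (0 , 0)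
    bottom-walk x≤X = walk-left 0 z≤n λ _ i≤x → (≤-trans i≤x x≤X , z≤n) , inj₂ refl

    origin-walk : Walk (S root) (0 , 0) (base root)
    origin-walk = Walk-sym (Walk-trans below-root (bottom-walk (m≤n⇒m≤1+n (≤-trans (l≤r root) (r≤X₀ root)))))

    top-walk : ∀ {x} → x ≤ X → Walk (S root) (x , Y) (base root)
    top-walk x≤X = Walk-trans (walk-left 0 z≤n λ {i} _ i≤x → (≤-trans i≤x x≤X , ≤-refl) , inj₂ (own-top i))
      (Walk-trans (walk-down 0 z≤n λ {i} _ i≤Y → (z≤n , i≤Y) , inj₂ (own-left i)) origin-walk)

    -- An uncovered point below the top has the owner of the point beneath it, so descending stays
    -- in the set until it reaches the rectangle or the bottom of the frame.
    own-walk : ∀ {v} x y → x ≤ X → y ≤ Y → own x y ≡ v → Walk (S v) (x , y) (base v)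
    own-walk x zero    x≤X y≤Y refl = Walk-trans (bottom-walk x≤X) origin-walk
    own-walk {v} x (suc y) x≤X y≤Y eq = go (Y ≤? suc y) (Fin.any? (λ v → cov? v (x , suc y))) refl refl
      where
      go : (dY : Dec (Y ≤ suc y)) (dC : Dec (∃ λ v → Cov v (x , suc y))) →
           (Y ≤? suc y) ≡ dY → Fin.any? (λ v → cov? v (x , suc y)) ≡ dC → Walk (S v) (x , suc y) (base v)
      go (yes Y≤) _ _ _ = subst (λ j → Walk (S v) (x , j) (base v)) (sym at-top)
        (subst (λ u → Walk (S u) (x , Y) (base u)) (trans (sym (trans (cong (own x) at-top) (own-top x))) eq) (top-walk x≤X))
        where
        at-top : suc y ≡ Y
        at-top = ≤-antisym y≤Y Y≤
      go (no _) (yes (_ , c)) _ _ =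
        subst (λ u → Walk (S u) (x , suc y) (base u)) eq (cov-walk (own-cov x (suc y) c))
      go (no ¬Y) (no ¬c) e₁ e₂ = step {e = vE x y} ((x≤X , y≤Y) , inj₂ eq) (inj₂ (refl , refl))
        (own-walk x y x≤X (≤-trans (n≤1+n y) y≤Y) (trans (sym fall) eq))
        where
        fall : own x (suc y) ≡ own x y
        fall rewrite e₁ | e₂ = refl

    to-base : ∀ {v p} → S v p → Walk (S v) p (base v)
    to-base (_ , inj₁ c)              = cov-walk c
    to-base ((x≤X , y≤Y) , inj₂ eq) = own-walk _ _ x≤X y≤Y eq

    drawing : Drawing G
    drawing = record
      { S = S ; S? = S? ; connected = λ s s′ → Walk-trans (to-base s) (Walk-sym (to-base s′))
      ; inhabited = λ v → base v , base∈ v ; share⇒adj = share⇒adj ; adj⇒share = adj⇒share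
      ; root = root ; root∋origin = (z≤n , z≤n) , inj₂ refl ; reach-root = λ v → reach v root
      ; box = grid ; S⊆box = λ s → ∈-grid (proj₁ (proj₁ s)) (proj₂ (proj₁ s))
      ; covered = λ {p} i → own (proj₁ p) (proj₂ p) , (in-grid i , inj₂ refl)
      ; whole = D₀ ; Q⊆box = Q⇒grid ; faces = all-faces ; whole⊆faces = D₀⊆faces }
      where
      in-grid : ∀ {p} → p ∈ grid → proj₁ p ≤ X × proj₂ p ≤ Y
      in-grid i with ∈-cartesianProduct⁻ _ _ i
      ... | x , y = s≤s⁻¹ (∈-upTo⁻ x) , s≤s⁻¹ (∈-upTo⁻ y)

    open Territory drawing hiding (V; S; S?; root; share⇒adj; adj⇒share)
    open Chase drawing
    open Game G 13 hiding (V)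

    frame-root : ∀ {x y} → x ≤ X → y ≤ Y → (x ≡ 0 ⊎ y ≡ Y) ⊎ (x ≡ X ⊎ y ≡ 0) → S root (x , y)
    frame-root {y = y} x≤ y≤ (inj₁ (inj₁ refl)) = (x≤ , y≤) , inj₂ (own-left y)
    frame-root {x}     x≤ y≤ (inj₁ (inj₂ refl)) = (x≤ , y≤) , inj₂ (own-top x)
    frame-root {y = y} x≤ y≤ (inj₂ (inj₁ refl)) = (x≤ , y≤) , inj₂ (own-right y)
    frame-root         x≤ y≤ (inj₂ (inj₂ refl)) = (x≤ , y≤) , inj₂ refl

    top-root : ∀ {p} → p ∈ verts (top X) → S root p
    top-root i with verts-top X i
    ... | x≤ , on , y≤ = frame-root x≤ y≤ (inj₁ on)

    right-root : ∀ {p} → p ∈ verts (right Y₀) → S root p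
    right-root i with verts-right Y₀ i
    ... | y≤ , on , x≤ = frame-root x≤ (m≤n⇒m≤1+n y≤) (inj₂ on)

    strung-root : ∀ {a} (γ : Path a) → (∀ {p} → p ∈ verts γ → S root p) → Strung γ
    strung-root γ on i = root , on (ends∈verts γ i (inj₁ (refl , refl))) , on (ends∈verts γ i (inj₂ (refl , refl)))

    -- The whole frame belongs to one set, so a single constant post guards it.
    root-guard : ∀ {D Z} → (∀ {p} → p ∈ Z → S root p) → Guard D Z
    root-guard on = record
      { post = λ _ → root ; post-root = refl ; post-share = λ _ → Share-refl root
      ; level = λ _ → 0 ; level-lip = λ _ _ _ → z≤n
      ; catch = λ _ _ fl z∈ → 0 , (_ , on z∈ , Flow-end fl) , z≤n , z≤n }

    siege₀ : Siege D₀ (top X) (right Y₀) tip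
    siege₀ = record
      { disc = disc₀ ; D⊆whole = id
      ; strung = strung-root (top X) top-root ; strung′ = strung-root (right Y₀) right-root
      ; guardₐ = root-guard top-root ; guard-b = root-guard right-root }

    squad : Fin 3 → Squad
    squad zero             = west
    squad (suc zero)       = east
    squad (suc (suc zero)) = spare

    -- Cops 1 to 12 are numbered by squad and place; cop 0 doubles a spare place.
    ρ₀ : Fin 13 → Role
    ρ₀ zero    = spare , zero
    ρ₀ (suc i) = squad (proj₁ (remQuot {3} 4 i)) , proj₂ (remQuot {3} 4 i)

    manned₀ : Manned ρ₀
    manned₀ (s , m) = suc (combine (number s) m) ,
      trans (cong (λ (q , m) → squad q , m) (Fin.remQuot-combine (number s) m)) (cong (_, m) (squad-number s))
      where
      number : Squad → Fin 3
      number west  = zero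
      number east  = suc zero
      number spare = suc (suc zero)
      squad-number : ∀ s → squad (number s) ≡ s
      squad-number west  = refl
      squad-number east  = refl
      squad-number spare = refl

    frame-point : ∀ {x y} → x ≤ X → y ≤ Y → ¬ Q D₀ (x , y) → (x ≡ 0 ⊎ y ≡ Y) ⊎ (x ≡ X ⊎ y ≡ 0)
    frame-point {zero}          _ _ _ = inj₁ (inj₁ refl)
    frame-point {suc x} {zero}  _ _ _ = inj₂ (inj₂ refl)
    frame-point {suc x} {suc y} x≤ y≤ ¬q with x ≟ X₀ | y ≟ Y₀
    ... | yes refl | _        = inj₂ (inj₁ refl)
    ... | no _     | yes refl = inj₁ (inj₂ refl)
    ... | no x≢    | no y≢    = ⊥-elim (¬q (interior (≤∧≢⇒< (s≤s⁻¹ x≤) x≢) (≤∧≢⇒< (s≤s⁻¹ y≤) y≢)))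

    cop-win : CopWin 13 G
    cop-win = (λ _ → root) , start
      where
      start : ∀ r → WinC (λ _ → root) r
      start r with in? D₀ r
      ... | yes i = cops (λ _ → root) (λ _ → inj₁ refl)
                      (win siege₀ (<-wellFounded _) ρ₀ manned₀ _ r i (λ _ _ _ → refl) (λ _ _ _ → refl))
      ... | no ¬i with any? (λ p → S? r p ×-dec ¬? (Q? D₀ p)) grid
      ...   | no none = ⊥-elim (¬i (mkIn at))
        where
        at : ∀ {p} → S r p → Q D₀ p
        at {p} s with Q? D₀ p
        ... | yes q = q
        ... | no ¬q = ⊥-elim (none (lose (∈-grid (proj₁ (proj₁ s)) (proj₂ (proj₁ s))) (s , ¬q)))
      ...   | yes out with find out
      ...     | p , _ , s , ¬q = lunge zero (p , frame-root (proj₁ (proj₁ s)) (proj₂ (proj₁ s))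
                                   (frame-point (proj₁ (proj₁ s)) (proj₂ (proj₁ s)) ¬q) , s)

-- From rational coordinates to ranks

rank : List ℚ → ℚ → ℕ
rank []       q = 0
rank (e ∷ es) q with e <ℚ? q
... | yes _ = suc (rank es q)
... | no _  = rank es q

rank-mono : ∀ es {p q} → p ≤ℚ q → rank es p ≤ rank es q
rank-mono []       p≤q = z≤n
rank-mono (e ∷ es) {p} {q} p≤q with e <ℚ? p | e <ℚ? q
... | yes _   | yes _  = s≤s (rank-mono es p≤q)
... | yes e<p | no e≮q = ⊥-elim (e≮q (ℚ.<-≤-trans e<p p≤q))
... | no _    | yes _  = m≤n⇒m≤1+n (rank-mono es p≤q)
... | no _    | no _   = rank-mono es p≤q

rank-strict : ∀ {es p q} → p ∈ es → p <ℚ q → rank es p < rank es q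
rank-strict {e ∷ es} {p} {q} (here refl) p<q with e <ℚ? p | e <ℚ? q
... | yes e<e | _      = ⊥-elim (ℚ.<-irrefl refl e<e)
... | no _    | yes _  = s≤s (rank-mono es (ℚ.<⇒≤ p<q))
... | no _    | no e≮q = ⊥-elim (e≮q p<q)
rank-strict {e ∷ es} {p} {q} (there i) p<q with e <ℚ? p | e <ℚ? q
... | yes _   | yes _  = s≤s (rank-strict i p<q)
... | yes e<p | no e≮q = ⊥-elim (e≮q (ℚ.<-trans e<p p<q))
... | no _    | yes _  = m≤n⇒m≤1+n (rank-strict i p<q)
... | no _    | no _   = rank-strict i p<q

-- Only `q` has to be listed. Overlap compares left ends with right ends, so a list of the right
-- ends alone preserves and reflects it.
rank-reflects : ∀ {es p q} → q ∈ es → rank es p ≤ rank es q → p ≤ℚ q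
rank-reflects {es} {p} {q} i le with p ≤ℚ? q
... | yes p≤q = p≤q
... | no p≰q  = ⊥-elim (<⇒≱ (rank-strict i (ℚ.≰⇒> p≰q)) le)

Crosses : Rect → Rect → Set
Crosses R S = (x₁ R ≤ℚ x₂ S × x₁ S ≤ℚ x₂ R) × (y₁ R ≤ℚ y₂ S × y₁ S ≤ℚ y₂ R)

Meet⇒Crosses : ∀ {R S} → Meet R S → Crosses R S
Meet⇒Crosses (p , ((a , b) , c , d) , (a′ , b′) , c′ , d′) =
  (ℚ.≤-trans a b′ , ℚ.≤-trans a′ b) , ℚ.≤-trans c d′ , ℚ.≤-trans c′ d

interval-point : ∀ {a b c d} → a ≤ℚ b → c ≤ℚ d → a ≤ℚ d → c ≤ℚ b → ∃ λ p → (a ≤ℚ p × p ≤ℚ b) × (c ≤ℚ p × p ≤ℚ d)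
interval-point {a} {c = c} a≤b c≤d a≤d c≤b with ℚ.≤-total a c
... | inj₁ a≤c = c , (a≤c , c≤b) , ℚ.≤-refl , c≤d
... | inj₂ c≤a = a , (ℚ.≤-refl , a≤b) , c≤a , a≤d

Crosses⇒Meet : ∀ {R S} → Crosses R S → Meet R S
Crosses⇒Meet {R} {S} ((a , b) , c , d)
  with interval-point (x₁≤x₂ R) (x₁≤x₂ S) a b | interval-point (y₁≤y₂ R) (y₁≤y₂ S) c d
... | x , xR , xS | y , yR , yS = (x , y) , (xR , yR) , xS , yS

upper-bound : (G : Graph) → TwoBox G → CopWin 13 G
upper-bound G ((v₀ , reach) , R , meets , irr) =
  Boxes.cop-win {G} reach v₀
    -- The successor keeps row and column 0 free of rectangles, as the frame requires.
    (λ v → suc (rank xs (x₁ (R v)))) (λ v → suc (rank xs (x₂ (R v))))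
    (λ v → suc (rank ys (y₁ (R v)))) (λ v → suc (rank ys (y₂ (R v))))
    (proj₁ X-bound) (proj₁ Y-bound)
    (λ v → s≤s (rank-mono xs (x₁≤x₂ (R v)))) (λ v → s≤s (rank-mono ys (y₁≤y₂ (R v))))
    (λ _ → s≤s z≤n) (λ _ → s≤s z≤n) (proj₂ X-bound) (proj₂ Y-bound)
    adj⇒ ⇒adj
  where
  xs ys : List ℚ
  xs = tabulate (x₂ ∘ R)
  ys = tabulate (y₂ ∘ R)
  X-bound : ∃ λ B → ∀ v → suc (rank xs (x₂ (R v))) ≤ B
  X-bound = fin-bound (λ v → suc (rank xs (x₂ (R v))))
  Y-bound : ∃ λ B → ∀ v → suc (rank ys (y₂ (R v))) ≤ B
  Y-bound = fin-bound (λ v → suc (rank ys (y₂ (R v))))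
  adj⇒ : ∀ {u v} → Adj G u v → _
  adj⇒ {u} {v} a with Meet⇒Crosses {R u} {R v} (proj₁ (meets u v λ { refl → irr u a }) a)
  ... | (p , q) , r , s = (s≤s (rank-mono xs p) , s≤s (rank-mono xs q)) , s≤s (rank-mono ys r) , s≤s (rank-mono ys s)
  ⇒adj : ∀ {u v} → u ≢ v → _ → Adj G u v
  ⇒adj {u} {v} ne ((p , q) , r , s) = proj₂ (meets u v ne) (Crosses⇒Meet {R u} {R v}
    ( (rank-reflects (∈-tabulate⁺ v) (s≤s⁻¹ p) , rank-reflects (∈-tabulate⁺ u) (s≤s⁻¹ q))
    , rank-reflects (∈-tabulate⁺ v) (s≤s⁻¹ r) , rank-reflects (∈-tabulate⁺ u) (s≤s⁻¹ s) ))

-- A graph on which two cops lose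

crosses? : ∀ R S → Dec (Crosses R S)
crosses? R S = (x₁ R ≤ℚ? x₂ S ×-dec x₁ S ≤ℚ? x₂ R) ×-dec (y₁ R ≤ℚ? y₂ S ×-dec y₁ S ≤ℚ? y₂ R)

Crosses-refl : ∀ R → Crosses R R
Crosses-refl R = (x₁≤x₂ R , x₁≤x₂ R) , y₁≤y₂ R , y₁≤y₂ R

Crosses-sym : ∀ {R S} → Crosses R S → Crosses S R
Crosses-sym ((a , b) , c , d) = (b , a) , d , c

ι : ℕ → ℚ
ι m = mkℚ (+ m) 0 (Coprime.sym (1-coprimeTo m))

rect : ∀ a b c d {a≤b : True (ι a ≤ℚ? ι b)} {c≤d : True (ι c ≤ℚ? ι d)} → Rect
rect a b c d {a≤b} {c≤d} = record
  { x₁ = ι a ; x₂ = ι b ; y₁ = ι c ; y₂ = ι d ; x₁≤x₂ = toWitness a≤b ; y₁≤y₂ = toWitness c≤d }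

-- The dodecahedron as a contact graph of rectangles: a frame of five rectangles, a ring of
-- ten around the centre and five in the middle, numbered along a Hamiltonian cycle.
tile : Fin 20 → Rect
tile = lookup
    ( rect 0 1 0 13 ∷ rect 1 13 12 13 ∷ rect 12 13 0 12 ∷ rect 7 12 0 1 ∷ rect 1 7 0 1
    ∷ rect 3 4 1 4 ∷ rect 4 9 2 4 ∷ rect 9 10 1 4 ∷ rect 10 11 3 7 ∷ rect 11 12 7 9
    ∷ rect 8 11 8 11 ∷ rect 5 8 10 12 ∷ rect 2 5 8 11 ∷ rect 4 6 6 8 ∷ rect 6 9 6 8
    ∷ rect 7 10 5 6 ∷ rect 5 7 4 5 ∷ rect 3 5 5 6 ∷ rect 2 3 3 7 ∷ rect 1 2 7 9
    ∷ [])

neighbour : Fin 20 → Fin 3 → Fin 20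
neighbour v = lookup (lookup
    ( (# 1 ∷ # 4 ∷ # 19 ∷ []) ∷ (# 0 ∷ # 2 ∷ # 11 ∷ []) ∷ (# 1 ∷ # 3 ∷ # 9 ∷ []) ∷ (# 2 ∷ # 4 ∷ # 7 ∷ [])
    ∷ (# 0 ∷ # 3 ∷ # 5 ∷ []) ∷ (# 4 ∷ # 6 ∷ # 18 ∷ []) ∷ (# 5 ∷ # 7 ∷ # 16 ∷ []) ∷ (# 3 ∷ # 6 ∷ # 8 ∷ [])
    ∷ (# 7 ∷ # 9 ∷ # 15 ∷ []) ∷ (# 2 ∷ # 8 ∷ # 10 ∷ []) ∷ (# 9 ∷ # 11 ∷ # 14 ∷ []) ∷ (# 1 ∷ # 10 ∷ # 12 ∷ [])
    ∷ (# 11 ∷ # 13 ∷ # 19 ∷ []) ∷ (# 12 ∷ # 14 ∷ # 17 ∷ []) ∷ (# 10 ∷ # 13 ∷ # 15 ∷ []) ∷ (# 8 ∷ # 14 ∷ # 16 ∷ [])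
    ∷ (# 6 ∷ # 15 ∷ # 17 ∷ []) ∷ (# 13 ∷ # 16 ∷ # 18 ∷ []) ∷ (# 5 ∷ # 17 ∷ # 19 ∷ []) ∷ (# 0 ∷ # 12 ∷ # 18 ∷ [])
    ∷ []) v)

Dom : Fin 20 → Fin 20 → Set
Dom u v = Crosses (tile u) (tile v)

dodecahedron : Graph
dodecahedron = record { n = 20 ; Adj = λ u v → u ≢ v × Meet (tile u) (tile v) }

3≤20 : 3 ≤ 20
3≤20 = s≤s (s≤s (s≤s z≤n))

abstract
  neighbour-adj : ∀ v i → v ≢ neighbour v i × Dom v (neighbour v i)
  neighbour-adj = from-yes (Fin.all? λ v → Fin.all? λ i →
    ¬? (v Fin.≟ neighbour v i) ×-dec crosses? (tile v) (tile (neighbour v i)))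

  path-adj : ∀ (i : Fin 19) → inject₁ i ≢ suc i × Dom (inject₁ i) (suc i)
  path-adj = from-yes (Fin.all? λ (i : Fin 19) →
    ¬? (inject₁ i Fin.≟ suc i) ×-dec crosses? (tile (inject₁ i)) (tile (suc i)))

  -- Checked by evaluation. It holds because the dodecahedron has girth five: dominating two
  -- neighbours of `v` would close a triangle or a 4-cycle.
  dominates-one : ∀ c v → c ≢ v → ∀ i j → Dom c (neighbour v i) → Dom c (neighbour v j) → i ≡ j
  dominates-one = from-yes (Fin.all? λ c → Fin.all? λ v → ¬? (c Fin.≟ v) →-dec (Fin.all? λ i → Fin.all? λ j →
    crosses? (tile c) (tile (neighbour v i)) →-dec (crosses? (tile c) (tile (neighbour v j)) →-dec (i Fin.≟ j))))

  dom? : ∀ u v → Dec (Dom u v)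
  dom? u v = crosses? (tile u) (tile v)

Reach-snoc : ∀ {G u v w} → Reach G u v → Adj G v w → Reach G u w
Reach-snoc here       a = step a here
Reach-snoc (step b ρ) a = step b (Reach-snoc ρ a)

Reach-trans : ∀ {G u v w} → Reach G u v → Reach G v w → Reach G u w
Reach-trans here       σ = σ
Reach-trans (step a ρ) σ = step a (Reach-trans ρ σ)

to-zero : ∀ v → Reach dodecahedron v zero × Reach dodecahedron zero v
to-zero = <-weakInduction _ (here , here) λ i (ρ , σ) → let ne , d = path-adj i in
  step (ne ∘ sym , Crosses⇒Meet {tile (suc i)} {tile (inject₁ i)} (Crosses-sym {tile (inject₁ i)} {tile (suc i)} d)) ρ ,
  Reach-snoc σ (ne , Crosses⇒Meet {tile (inject₁ i)} {tile (suc i)} d)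

two-box : TwoBox dodecahedron
two-box = (zero , λ u v → Reach-trans (proj₁ (to-zero u)) (proj₂ (to-zero v)))
        , tile , (λ u v ne → proj₂ , (ne ,_)) , λ u (ne , _) → ne refl

AtMostOne : (Fin 3 → Set) → Set
AtMostOne A = ∀ i j → A i → A j → i ≡ j

-- Pigeonhole for two cops and three places, applied both to the neighbours of the robber and to his
-- starting positions.
untouched : ∀ {A B : Fin 3 → Set} → (∀ i → Dec (A i)) → (∀ i → Dec (B i)) →
            AtMostOne A → AtMostOne B → ∃ λ i → ¬ A i × ¬ B i
untouched {A} {B} A? B? a b with Fin.any? (λ i → ¬? (A? i) ×-dec ¬? (B? i))
... | yes found = found
... | no none   = ⊥-elim (clash (hit (# 0)) (hit (# 1)) (hit (# 2)))
  where
  hit : ∀ i → A i ⊎ B i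
  hit i with A? i | B? i
  ... | yes x | _     = inj₁ x
  ... | no _  | yes y = inj₂ y
  ... | no ¬x | no ¬y = ⊥-elim (none (i , ¬x , ¬y))
  clash : A (# 0) ⊎ B (# 0) → A (# 1) ⊎ B (# 1) → A (# 2) ⊎ B (# 2) → ⊥
  clash (inj₁ x) (inj₁ y) _ with () ← a (# 0) (# 1) x y
  clash (inj₂ x) (inj₂ y) _ with () ← b (# 0) (# 1) x y
  clash (inj₁ x) _ (inj₁ z) with () ← a (# 0) (# 2) x z
  clash (inj₂ x) _ (inj₂ z) with () ← b (# 0) (# 2) x z
  clash _ (inj₁ y) (inj₁ z) with () ← a (# 1) (# 2) y z
  clash _ (inj₂ y) (inj₂ z) with () ← b (# 1) (# 2) y z

open Game dodecahedron 2

both : ∀ {P : Fin 2 → Set} → P (# 0) → P (# 1) → ∀ i → P i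
both x y zero       = x
both x y (suc zero) = y

escape : ∀ (C : Config) r → (∀ i → C i ≢ r) → ∃ λ j → ∀ i → ¬ Dom (C i) (neighbour r j)
escape C r ne = let j , x , y = free in j , both x y
  where
  free : ∃ λ j → ¬ Dom (C (# 0)) (neighbour r j) × ¬ Dom (C (# 1)) (neighbour r j)
  free = untouched (λ j → dom? (C (# 0)) (neighbour r j)) (λ j → dom? (C (# 1)) (neighbour r j))
                   (dominates-one _ r (ne (# 0))) (dominates-one _ r (ne (# 1)))

mutual
  evadeC : ∀ {C r} → (∀ i → ¬ Dom (C i) r) → ¬ WinC C r
  evadeC {r = r} safe (caughtC (i , refl)) = safe i (Crosses-refl (tile r))
  evadeC {C} {r} safe (cops C′ moves w) = evadeR {C′} {r} away w
    where
    away : ∀ i → C′ i ≢ r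
    away i refl with moves i
    ... | inj₁ eq      = safe i (subst (λ u → Dom u (C′ i)) eq (Crosses-refl (tile (C′ i))))
    ... | inj₂ (_ , m) = safe i (Meet⇒Crosses {tile (C i)} {tile (C′ i)} m)

  evadeR : ∀ {C r} → (∀ i → C i ≢ r) → ¬ WinR C r
  evadeR away (caughtR (i , eq)) = away i eq
  evadeR {C} {r} away (robber w) = let j , safe = escape C r away ; ne , d = neighbour-adj r j in
    evadeC {C} {neighbour r j} safe (w (neighbour r j) (inj₂ (ne , Crosses⇒Meet {tile r} {tile (neighbour r j)} d)))

lower-bound : ¬ CopWin 2 dodecahedron
-- Two cops leave one of three vertices unoccupied. The robber starts on the neighbour to which he
-- would flee from there, which no cop dominates.
lower-bound (C , w) = let i , x , y = free ; j , safe = escape C (spot i) (both x y) in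
  evadeC {C} {neighbour (spot i) j} safe (w _)
  where
  spot : Fin 3 → Fin 20
  spot i = inject≤ i 3≤20
  free : ∃ λ i → C (# 0) ≢ spot i × C (# 1) ≢ spot i
  free = untouched (λ i → C (# 0) Fin.≟ spot i) (λ i → C (# 1) Fin.≟ spot i)
    (λ i j p q → Fin.inject≤-injective 3≤20 3≤20 i j (trans (sym p) q))
    (λ i j p q → Fin.inject≤-injective 3≤20 3≤20 i j (trans (sym p) q))

theorem6 : ((G : Graph) → TwoBox G → CopWin 13 G)
    × Σ Graph (λ G → TwoBox G × ¬ CopWin 2 G)
theorem6 = upper-bound , dodecahedron , two-box , lower-bound
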